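{- For all integers $n\geq 0$ and $k\geq 0$, \[ b\left(3^{2(k+1)}n+\frac{5\cdot 3^{2(k+1)}+3}{8}\right)\equiv (-1)^k\, b(9n+6)\pmod{3}, \] and for all integers $n\geq 0$, \[ b(81n+24)\equiv -\,b(9n+3)\pmod{3}. \]
   Context: For $m\in\mathbb{N}$ and $|q|<1$ let $f_m:=\prod_{n\geq 1}(1-q^{mn})$. Let $b(n)$ denote the number of partition triples $(\pi_1,\pi_2,\pi_3)$ of $n$ (i.e. $\pi_1,\pi_2,\pi_3$ are partitions whose sizes sum to $n$) such that $\pi_1$ consists of distinct odd parts and $\pi_2$ and $\pi_3$ consist of parts divisible by $4$, with $b(0)=1$. Equivalently, $\sum_{n\geq 0} b(n)q^n = \dfrac{f_2^2}{f_1f_4^3}$. -}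

module Defs where

open import Data.Integer.Base as ℤ using (ℤ)
open import Data.Integer.Divisibility as ℤ using ()
open import Data.List.Base using (List; []; _∷_; length; filter; upTo; cartesianProduct; cartesianProductWith)
open import Data.List.Membership.Propositional using (_∈_)
open import Data.List.Membership.Propositional.Properties using (∈-filter⁺; ∈-filter⁻; ∈-upTo⁺; ∈-cartesianProduct⁺; ∈-cartesianProduct⁻; ∈-cartesianProductWith⁺; ∈-cartesianProductWith⁻)
open import Data.List.Properties using (∷-injective)
open import Data.List.Relation.Unary.All as All using (All; []; _∷_)
open import Data.List.Relation.Unary.Any using (here; there)
open import Data.List.Relation.Unary.Linked as Linked using (Linked; [])
open import Data.List.Relation.Unary.AllPairs using ([]; _∷_)
open import Data.List.Relation.Unary.Unique.DecPropositional using (unique?)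
open import Data.List.Relation.Unary.Unique.Propositional using (Unique)
import Data.List.Relation.Unary.Unique.Propositional.Properties as Unique
open import Data.Nat.Base using (ℕ; zero; suc; _+_; _*_; _^_; _≤_; _<_; _≥_; s≤s; z≤n)
open import Data.Nat.Divisibility using (_∣_; _∤_; _∣?_; divides; ∣m∣n⇒∣m+n; n∣m*n)
open import Data.Nat.ListAction using (sum)
open import Data.Nat.Properties using (_≟_; _≤?_; _<?_; _≥?_; ≤-trans; ≤-reflexive; m≤m+n; m≤n+m; +-mono-≤; ^-*-assoc)
open import Data.Nat.Tactic.RingSolver using (solve-∀)
open import Data.Product.Base using (_×_; _,_; proj₁; proj₂)
open import Function.Bundles using (_⇔_; mk⇔)
open import Relation.Binary.PropositionalEquality using (_≡_; _≢_; refl; sym; subst)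
open import Relation.Nullary.Decidable using (¬?; _×-dec_)
open import Relation.Unary using (Decidable)

infix 4 _≈_[mod_]

_≈_[mod_] : ℤ → ℤ → ℕ → Set
a ≈ b [mod m ] = ℤ.+ m ℤ.∣ (a ℤ.- b)

-- A partition is the list of its parts in nonincreasing order; its size is `sum`.
IsPartition : List ℕ → Set
IsPartition π = All (0 <_) π × Linked _≥_ π

DistinctOddParts : List ℕ → Set
DistinctOddParts π = Unique π × All (2 ∤_) π

PartsDivisibleBy4 : List ℕ → Set
PartsDivisibleBy4 = All (4 ∣_)

Triple : Set
Triple = List ℕ × List ℕ × List ℕ

size : Triple → ℕ
size (π₁ , π₂ , π₃) = sum π₁ + (sum π₂ + sum π₃)

record Admissible (n : ℕ) (t : Triple) : Set where
  constructor admissible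
  private
    π₁ = proj₁ t
    π₂ = proj₁ (proj₂ t)
    π₃ = proj₂ (proj₂ t)
  field
    partition₁ : IsPartition π₁
    partition₂ : IsPartition π₂
    partition₃ : IsPartition π₃
    size≡n     : size t ≡ n
    parts₁     : DistinctOddParts π₁
    parts₂     : PartsDivisibleBy4 π₂
    parts₃     : PartsDivisibleBy4 π₃

isPartition? : Decidable IsPartition
isPartition? π = All.all? (0 <?_) π ×-dec Linked.linked? _≥?_ π

distinctOddParts? : Decidable DistinctOddParts
distinctOddParts? π = unique? _≟_ π ×-dec All.all? (λ p → ¬? (2 ∣? p)) π

partsDivisibleBy4? : Decidable PartsDivisibleBy4
partsDivisibleBy4? = All.all? (4 ∣?_)

-- Partitions with at most l parts and size at most n.
partitionsOfLength≤ : ℕ → ℕ → List (List ℕ)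
partitionsOfLength≤ n zero    = [] ∷ []
partitionsOfLength≤ n (suc l) = [] ∷
  filter (λ π → isPartition? π ×-dec (sum π ≤? n))
    (cartesianProductWith _∷_ (upTo (suc n)) (partitionsOfLength≤ n l))

partitions≤ : ℕ → List (List ℕ)
partitions≤ n = partitionsOfLength≤ n n

-- All admissible triples of total size n, each listed once: see ∈-triples and triples-unique.
triples : ℕ → List Triple
triples n =
  filter (λ t → size t ≟ n)
    (cartesianProduct (filter distinctOddParts? (partitions≤ n))
      (cartesianProduct (filter partsDivisibleBy4? (partitions≤ n))
        (filter partsDivisibleBy4? (partitions≤ n))))

b : ℕ → ℕ
b n = length (triples n)

b0≡1 : b 0 ≡ 1
b0≡1 = refl

private
  length≤sum : ∀ {π} → All (0 <_) π → length π ≤ sum π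
  length≤sum []         = z≤n
  length≤sum (p>0 ∷ ps) = +-mono-≤ p>0 (length≤sum ps)

  sound : ∀ n l {π} → π ∈ partitionsOfLength≤ n l → IsPartition π
  sound n zero    (here refl) = [] , []
  sound n (suc l) (here refl) = [] , []
  sound n (suc l) (there π∈) =
    proj₁ (proj₂ (∈-filter⁻ (λ π → isPartition? π ×-dec (sum π ≤? n))
      {xs = cartesianProductWith _∷_ (upTo (suc n)) (partitionsOfLength≤ n l)} π∈))

  complete : ∀ n l {π} → IsPartition π → sum π ≤ n → length π ≤ l → π ∈ partitionsOfLength≤ n l
  complete n zero    {[]}    _ _ _ = here refl
  complete n (suc l) {[]}    _ _ _ = here refl
  complete n (suc l) {p ∷ π} (p>0 ∷ pos , dec) s≤n (s≤s len≤l) = there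
    (∈-filter⁺ (λ π → isPartition? π ×-dec (sum π ≤? n))
      (∈-cartesianProductWith⁺ _∷_
        (∈-upTo⁺ (s≤s (≤-trans (m≤m+n p (sum π)) s≤n)))
        (complete n l (pos , Linked.tail dec) (≤-trans (m≤n+m (sum π) p) s≤n) len≤l))
      ((p>0 ∷ pos , dec) , s≤n))

  unique : ∀ n l → Unique (partitionsOfLength≤ n l)
  unique n zero    = [] ∷ []
  unique n (suc l) = All.tabulate []≢ ∷
    Unique.filter⁺ P? (Unique.cartesianProductWith⁺ _∷_ ∷-injective (Unique.upTo⁺ (suc n)) (unique n l))
    where
    P? = λ π → isPartition? π ×-dec (sum π ≤? n)
    xs = cartesianProductWith _∷_ (upTo (suc n)) (partitionsOfLength≤ n l)
    []≢ : ∀ {π} → π ∈ filter P? xs → [] ≢ π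
    []≢ π∈ refl with ∈-cartesianProductWith⁻ _∷_ (upTo (suc n)) (partitionsOfLength≤ n l) (proj₁ (∈-filter⁻ P? {xs = xs} π∈))
    ... | _ , _ , _ , _ , ()

  complete≤ : ∀ n {π} → IsPartition π → sum π ≤ n → π ∈ partitions≤ n
  complete≤ n p s≤n = complete n n p s≤n (≤-trans (length≤sum (proj₁ p)) s≤n)

∈-triples : ∀ n t → t ∈ triples n ⇔ Admissible n t
∈-triples n t@(π₁ , π₂ , π₃) = mk⇔ to from
  where
  D = filter distinctOddParts? (partitions≤ n)
  F = filter partsDivisibleBy4? (partitions≤ n)

  to : t ∈ triples n → Admissible n t
  to t∈ with ∈-filter⁻ (λ t → size t ≟ n) {xs = cartesianProduct D (cartesianProduct F F)} t∈
  ... | t∈′ , eq with ∈-cartesianProduct⁻ D (cartesianProduct F F) t∈′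
  ... | x∈ , yz∈ with ∈-cartesianProduct⁻ F F yz∈
  ... | y∈ , z∈ with ∈-filter⁻ distinctOddParts? {xs = partitions≤ n} x∈
                   | ∈-filter⁻ partsDivisibleBy4? {xs = partitions≤ n} y∈
                   | ∈-filter⁻ partsDivisibleBy4? {xs = partitions≤ n} z∈
  ... | x , dx | y , dy | z , dz = admissible (sound n n x) (sound n n y) (sound n n z) eq dx dy dz

  from : Admissible n t → t ∈ triples n
  from (admissible p₁ p₂ p₃ eq d₁ d₂ d₃) =
    ∈-filter⁺ (λ t → size t ≟ n)
      (∈-cartesianProduct⁺ (∈-filter⁺ distinctOddParts? (complete≤ n p₁ s₁) d₁)
        (∈-cartesianProduct⁺ (∈-filter⁺ partsDivisibleBy4? (complete≤ n p₂ s₂) d₂)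
          (∈-filter⁺ partsDivisibleBy4? (complete≤ n p₃ s₃) d₃)))
      eq
    where
    s₂₃ = ≤-trans (m≤n+m (sum π₂ + sum π₃) (sum π₁)) (≤-reflexive eq)
    s₁ = ≤-trans (m≤m+n (sum π₁) (sum π₂ + sum π₃)) (≤-reflexive eq)
    s₂ = ≤-trans (m≤m+n (sum π₂) (sum π₃)) s₂₃
    s₃ = ≤-trans (m≤n+m (sum π₃) (sum π₂)) s₂₃

triples-unique : ∀ n → Unique (triples n)
triples-unique n = Unique.filter⁺ (λ t → size t ≟ n)
  (Unique.cartesianProduct⁺ (Unique.filter⁺ distinctOddParts? (unique n n))
    (Unique.cartesianProduct⁺ (Unique.filter⁺ partsDivisibleBy4? (unique n n))
      (Unique.filter⁺ partsDivisibleBy4? (unique n n))))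

-- (5·3^{2(k+1)} + 3)/8 is an integer, so ℕ-division by 8 gives its exact value.
8∣5*3^[2*[1+k]]+3 : ∀ k → 8 ∣ 5 * 3 ^ (2 * suc k) + 3
8∣5*3^[2*[1+k]]+3 k = subst (λ x → 8 ∣ 5 * x + 3) (^-*-assoc 3 2 (suc k)) (go (suc k))
  where
  step : ∀ x → 5 * (9 * x) + 3 ≡ (5 * x + 3) + 5 * x * 8
  step = solve-∀
  go : ∀ j → 8 ∣ 5 * 9 ^ j + 3
  go zero    = divides 1 refl
  go (suc j) = subst (8 ∣_) (sym (step (9 ^ j))) (∣m∣n⇒∣m+n (go j) (n∣m*n (5 * 9 ^ j)))

{-# OPTIONS --safe #-}
module Submission where

-- Write f_m for ∏ (1 - q^{mn}) and work in 𝔽₃[[q]], where f_{3m} = f_m³.  Let U_j f = ∑ f(3n+j) qⁿ; then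
-- U_j (a³ f) = a U_j f.  With x = f₁, y = f₂, z = f₄, Gauss's identities say that ψ = ∑ q^{n(n+1)/2} = y²/x and
-- φ = ∑ (-1)ⁿ q^{n²} = x²/y, and from the exponents U₁ψ = ψ³, U₂ψ = 0, U₀φ = φ³, U₂φ = 0.  As φ²ψ = x³ is a
-- cube, U₁ of it vanishes, which amounts to 1 = qψ⁸ + φ⁸, i.e. x⁸y⁸ = x²⁴ + q y²⁴.  Combining this relation with
-- its image under q ↦ q² gives x⁸ = y⁴ + q z⁸ and y²⁴ = x¹⁶z⁸ + q x⁸z¹⁶.  These relations determine the
-- required sections of ∑ b(n) qⁿ = y²/(x z³) = ψ/z³:  C = ∑ b(9n+6) qⁿ is x⁷z⁵/y⁶, U₂C = -x⁵z⁷/y⁶,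
-- U₁U₂C = -C, and U₀U₂C = -∑ b(9n+3) qⁿ.

open import Defs
open import Algebra.Bundles using (CommutativeRing; RawRing)
open import Algebra.Definitions using (Associative; Commutative; Congruent₂; LeftIdentity; _DistributesOverʳ_)
import Algebra.Solver.Ring
import Algebra.Solver.Ring.AlmostCommutativeRing as ACR
open import Algebra.Structures using (IsCommutativeRing)
open import Data.Fin.Base using (Fin)
open import Data.Fin.Patterns using (0F; 1F; 2F)
open import Data.Fin.Properties using (all?; _≟_)
open import Data.Integer.Base as ℤ using (-1ℤ)
import Data.Integer.Divisibility as ℤ∣
import Data.Integer.Divisibility.Signed as Signed
import Data.Integer.Properties as ℤ
import Data.Integer.Tactic.RingSolver as ℤRing
open import Data.List.Base using (List; []; _∷_; _++_; map; length; filter; cartesianProduct)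
open import Data.List.Membership.Propositional using (_∈_)
open import Data.List.Membership.Propositional.Properties using (∈-++⁻; ∈-++⁺ˡ; ∈-++⁺ʳ; ∈-map⁺; ∈-map⁻; ∈-filter⁺; ∈-filter⁻; ∈-cartesianProduct⁺; ∈-cartesianProduct⁻)
open import Data.List.Membership.Propositional.Properties.WithK using (unique∧set⇒bag)
open import Data.List.Properties using (∷-injectiveʳ; filter-accept; filter-reject)
open import Data.List.Relation.Binary.BagAndSetEquality using (∼bag⇒↭)
open import Data.List.Relation.Binary.Permutation.Propositional.Properties using (↭-length)
open import Data.List.Relation.Unary.All as All using (All; []; _∷_)
open import Data.List.Relation.Unary.AllPairs as AllPairs using ([]; _∷_)
open import Data.List.Relation.Unary.Any using (here)
open import Data.List.Relation.Unary.Linked as Linked using (Linked; []; [-]; _∷_)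
open import Data.List.Relation.Unary.Linked.Properties using (Linked⇒AllPairs)
open import Data.List.Relation.Unary.Unique.Propositional using (Unique)
import Data.List.Relation.Unary.Unique.Propositional.Properties as Unique
open import Data.Maybe.Base as Maybe using (Maybe)
open import Data.Nat.Base as ℕ using (ℕ; zero; suc; _≤_; _<_; _≥_; s≤s; z≤n)
open import Data.Nat.DivMod using (m*n/n≡m)
open import Data.Nat.Divisibility using (_∣_; _∤_; divides; ∣m+n∣m⇒∣n; ∣m∣n⇒∣m+n; ∣-refl; _∣0; ∣1⇒≡1; n∣m*n)
open import Data.Nat.ListAction using (sum)
import Data.Nat.Properties as ℕ
open import Data.Nat.Tactic.RingSolver using (solve-∀)
open import Data.Product.Base using (_,_; _×_; ∃; proj₁; proj₂)
open import Data.Sum.Base using (inj₁; inj₂)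
open import Function.Bundles using (mk⇔; Equivalence)
open import Level using (0ℓ)
open import Relation.Binary.PropositionalEquality as ≡ using (_≡_; _≢_; cong; cong₂; module ≡-Reasoning)
open import Relation.Nullary.Decidable using (yes; no; toWitness; dec⇒maybe; _→-dec_)
open import Relation.Nullary.Negation using (contradiction)

-- The exponents give ψ = α³ + qψ⁹ and φ = φ⁹ + qβ³ with α = U₀ψ and β = U₁φ. The vanishing of
-- U₁(φ²ψ) then says αβ = φ³ψ³, whose cube is (ψ - qψ⁹)(φ - φ⁹) = qφ⁹ψ⁹; cancelling φψ leaves 1 =
-- qψ⁸ + φ⁸. Only cubes can be pulled out of U_j, so each section is computed by splitting off cubes
-- until a small remainder is left. These remainders are xz² and x²z, and their sections are tied
-- down by applying U_j to x⁹ and y²⁴, where the left side is a cube and its sections are known.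
-- Division is avoided: every quotient is stated with its denominators cleared, and factors are
-- cancelled when their constant term is 1. Cube roots are unique because cubing is the injective
-- substitution q ↦ q³; the one square root needed comes from factoring a difference of squares. On
-- the combinatorial side, the triples are recounted through lists whose recursions match those of
-- the finite products.

𝔽₃ : Set
𝔽₃ = Fin 3

-- Arithmetic of the field with three elements

module 𝔽₃ where

  infixl 6 _+_
  infixl 7 _*_
  infix  8 -_

  next : 𝔽₃ → 𝔽₃
  next 0F = 1F
  next 1F = 2F
  next 2F = 0F

  _+_ : 𝔽₃ → 𝔽₃ → 𝔽₃
  0F + y = y
  1F + y = next y
  2F + y = next (next y)

  -_ : 𝔽₃ → 𝔽₃
  - 0F = 0F
  - 1F = 2F
  - 2F = 1F

  _*_ : 𝔽₃ → 𝔽₃ → 𝔽₃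
  0F * y = 0F
  1F * y = y
  2F * y = - y

  +-assoc : ∀ x y z → (x + y) + z ≡ x + (y + z)
  +-assoc = toWitness {a? = all? λ x → all? λ y → all? λ z → (x + y) + z ≟ x + (y + z)} _

  +-comm : ∀ x y → x + y ≡ y + x
  +-comm = toWitness {a? = all? λ x → all? λ y → x + y ≟ y + x} _

  +-identityʳ : ∀ x → x + 0F ≡ x
  +-identityʳ x = +-comm x 0F

  -‿inverseˡ : ∀ x → - x + x ≡ 0F
  -‿inverseˡ = toWitness {a? = all? λ x → - x + x ≟ 0F} _

  *-assoc : ∀ x y z → (x * y) * z ≡ x * (y * z)
  *-assoc = toWitness {a? = all? λ x → all? λ y → all? λ z → (x * y) * z ≟ x * (y * z)} _

  *-comm : ∀ x y → x * y ≡ y * x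
  *-comm = toWitness {a? = all? λ x → all? λ y → x * y ≟ y * x} _

  *-zeroʳ : ∀ x → x * 0F ≡ 0F
  *-zeroʳ x = *-comm x 0F

  *-distribˡ-+ : ∀ x y z → x * (y + z) ≡ x * y + x * z
  *-distribˡ-+ = toWitness {a? = all? λ x → all? λ y → all? λ z → x * (y + z) ≟ x * y + x * z} _

  *-distribʳ-+ : ∀ z x y → (x + y) * z ≡ x * z + y * z
  *-distribʳ-+ z x y = ≡.trans (*-comm (x + y) z) (≡.trans (*-distribˡ-+ z x y) (cong₂ _+_ (*-comm z x) (*-comm z y)))

  interchange : ∀ a b c d → (a + b) + (c + d) ≡ (a + c) + (b + d)
  interchange = toWitness {a? = all? λ a → all? λ b → all? λ c → all? λ d → (a + b) + (c + d) ≟ (a + c) + (b + d)} _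

  +-cancelʳ : ∀ a b c → a + c ≡ b + c → a ≡ b
  +-cancelʳ = toWitness {a? = all? λ a → all? λ b → all? λ c → (a + c ≟ b + c) →-dec (a ≟ b)} _

  next³ : ∀ x → next (next (next x)) ≡ x
  next³ = toWitness {a? = all? λ x → next (next (next x)) ≟ x} _

-- Formal power series over 𝔽₃

module PowerSeries where

  Series : Set
  Series = ℕ → 𝔽₃

  infix 4 _≈_

  -- A record, not a bare function type, so that both series can be inferred from a proof of
  -- equality.
  record _≈_ (f g : Series) : Set where
    constructor pointwise
    field coeff : ∀ n → f n ≡ g n
  open _≈_ public

  tail : Series → Series
  tail f n = f (suc n)

  constant : 𝔽₃ → Series
  constant c zero    = c
  constant c (suc _) = 0F

  X : Series
  X zero    = 0F
  X (suc n) = constant 1F n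

  infixl 6 _⊞_
  infixl 7 _⊠_ _·_

  opaque

    _⊞_ : Series → Series → Series
    (f ⊞ g) n = f n 𝔽₃.+ g n

    ⊟_ : Series → Series
    (⊟ f) n = 𝔽₃.- f n

    _·_ : 𝔽₃ → Series → Series
    (c · f) n = c 𝔽₃.* f n

    -- The Cauchy product, in the recursive form given by f = f(0) + q · `tail f`.
    _⊠_ : Series → Series → Series
    (f ⊠ g) zero    = f 0 𝔽₃.* g 0
    (f ⊠ g) (suc n) = f 0 𝔽₃.* g (suc n) 𝔽₃.+ (tail f ⊠ g) n

    ⊠-cong-≤ : ∀ {f f′ g g′} n → (∀ i → i ≤ n → f i ≡ f′ i) → (∀ i → i ≤ n → g i ≡ g′ i) → (f ⊠ g) n ≡ (f′ ⊠ g′) n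
    ⊠-cong-≤ zero    p q = cong₂ 𝔽₃._*_ (p 0 z≤n) (q 0 z≤n)
    ⊠-cong-≤ (suc n) p q = cong₂ 𝔽₃._+_ (cong₂ 𝔽₃._*_ (p 0 z≤n) (q (suc n) ℕ.≤-refl))
      (⊠-cong-≤ n (λ i i≤n → p (suc i) (s≤s i≤n)) (λ i i≤n → q i (ℕ.m≤n⇒m≤1+n i≤n)))

    ⊠-cong : Congruent₂ _≈_ _⊠_
    ⊠-cong p q = pointwise λ n → ⊠-cong-≤ n (λ i _ → coeff p i) (λ i _ → coeff q i)

    ⊠-distribʳ-⊞ : _DistributesOverʳ_ _≈_ _⊠_ _⊞_
    ⊠-distribʳ-⊞ h f g = pointwise (go f g)
      where
      go : ∀ f g n → ((f ⊞ g) ⊠ h) n ≡ (f ⊠ h) n 𝔽₃.+ (g ⊠ h) n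
      go f g zero    = 𝔽₃.*-distribʳ-+ (h 0) (f 0) (g 0)
      go f g (suc n) = ≡.trans
        (cong₂ 𝔽₃._+_ (𝔽₃.*-distribʳ-+ (h (suc n)) (f 0) (g 0)) (go (tail f) (tail g) n))
        (𝔽₃.interchange (f 0 𝔽₃.* h (suc n)) (g 0 𝔽₃.* h (suc n)) ((tail f ⊠ h) n) ((tail g ⊠ h) n))

    ·-⊠ : ∀ c f g n → ((c · f) ⊠ g) n ≡ c 𝔽₃.* (f ⊠ g) n
    ·-⊠ c f g zero    = 𝔽₃.*-assoc c (f 0) (g 0)
    ·-⊠ c f g (suc n) = ≡.trans
      (cong₂ 𝔽₃._+_ (𝔽₃.*-assoc c (f 0) (g (suc n))) (·-⊠ c (tail f) g n))
      (≡.sym (𝔽₃.*-distribˡ-+ c (f 0 𝔽₃.* g (suc n)) ((tail f ⊠ g) n)))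

    -- The recursion of `_⊠_` takes off the head of the left factor; this mirror image takes off the
    -- head of the right one. Commutativity compares the two, and cancellation of a left factor uses
    -- it to pass to tails.
    ⊠-suc : ∀ f g n → (f ⊠ g) (suc n) ≡ (f ⊠ tail g) n 𝔽₃.+ f (suc n) 𝔽₃.* g 0
    ⊠-suc f g zero    = ≡.refl
    ⊠-suc f g (suc n) = ≡.trans
      (cong (f 0 𝔽₃.* g (suc (suc n)) 𝔽₃.+_) (⊠-suc (tail f) g n))
      (≡.sym (𝔽₃.+-assoc (f 0 𝔽₃.* g (suc (suc n))) ((tail f ⊠ tail g) n) (f (suc (suc n)) 𝔽₃.* g 0)))

    ⊠-comm : Commutative _≈_ _⊠_
    ⊠-comm f g = pointwise (go f g)
      where
      go : ∀ f g n → (f ⊠ g) n ≡ (g ⊠ f) n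
      go f g zero    = 𝔽₃.*-comm (f 0) (g 0)
      go f g (suc n) = begin
        f 0 𝔽₃.* g (suc n) 𝔽₃.+ (tail f ⊠ g) n ≡⟨ cong₂ 𝔽₃._+_ (𝔽₃.*-comm (f 0) (g (suc n))) (go (tail f) g n) ⟩
        g (suc n) 𝔽₃.* f 0 𝔽₃.+ (g ⊠ tail f) n ≡⟨ 𝔽₃.+-comm (g (suc n) 𝔽₃.* f 0) ((g ⊠ tail f) n) ⟩
        (g ⊠ tail f) n 𝔽₃.+ g (suc n) 𝔽₃.* f 0 ≡⟨ ⊠-suc g f n ⟨
        (g ⊠ f) (suc n)                         ∎
        where open ≡-Reasoning

    ⊠-assoc : Associative _≈_ _⊠_
    ⊠-assoc f g h = pointwise (go f g)
      where
      go : ∀ f g n → ((f ⊠ g) ⊠ h) n ≡ (f ⊠ (g ⊠ h)) n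
      go f g zero    = 𝔽₃.*-assoc (f 0) (g 0) (h 0)
      go f g (suc n) = begin
        f 0 𝔽₃.* g 0 𝔽₃.* h (suc n) 𝔽₃.+ ((f 0 · tail g ⊞ tail f ⊠ g) ⊠ h) n
          ≡⟨ cong (f 0 𝔽₃.* g 0 𝔽₃.* h (suc n) 𝔽₃.+_) (coeff (⊠-distribʳ-⊞ h (f 0 · tail g) (tail f ⊠ g)) n) ⟩
        f 0 𝔽₃.* g 0 𝔽₃.* h (suc n) 𝔽₃.+ ((f 0 · tail g ⊠ h) n 𝔽₃.+ (tail f ⊠ g ⊠ h) n)
          ≡⟨ 𝔽₃.+-assoc (f 0 𝔽₃.* g 0 𝔽₃.* h (suc n)) ((f 0 · tail g ⊠ h) n) ((tail f ⊠ g ⊠ h) n) ⟨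
        f 0 𝔽₃.* g 0 𝔽₃.* h (suc n) 𝔽₃.+ (f 0 · tail g ⊠ h) n 𝔽₃.+ (tail f ⊠ g ⊠ h) n
          ≡⟨ cong₂ 𝔽₃._+_ (cong₂ 𝔽₃._+_ (𝔽₃.*-assoc (f 0) (g 0) (h (suc n))) (·-⊠ (f 0) (tail g) h n)) (go (tail f) g n) ⟩
        f 0 𝔽₃.* (g 0 𝔽₃.* h (suc n)) 𝔽₃.+ f 0 𝔽₃.* (tail g ⊠ h) n 𝔽₃.+ (tail f ⊠ (g ⊠ h)) n
          ≡⟨ cong (𝔽₃._+ (tail f ⊠ (g ⊠ h)) n) (𝔽₃.*-distribˡ-+ (f 0) (g 0 𝔽₃.* h (suc n)) ((tail g ⊠ h) n)) ⟨
        f 0 𝔽₃.* (g 0 𝔽₃.* h (suc n) 𝔽₃.+ (tail g ⊠ h) n) 𝔽₃.+ (tail f ⊠ (g ⊠ h)) n ∎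
        where open ≡-Reasoning

    ⊠-zeroˡ : ∀ {f} g → (∀ n → f n ≡ 0F) → ∀ n → (f ⊠ g) n ≡ 0F
    ⊠-zeroˡ {f} g f≡0 zero    = cong (𝔽₃._* g 0) (f≡0 0)
    ⊠-zeroˡ {f} g f≡0 (suc n) = cong₂ 𝔽₃._+_ (cong (𝔽₃._* g (suc n)) (f≡0 0)) (⊠-zeroˡ g (λ i → f≡0 (suc i)) n)

    ⊠-constantˡ : ∀ c g n → (constant c ⊠ g) n ≡ c 𝔽₃.* g n
    ⊠-constantˡ c g zero    = ≡.refl
    ⊠-constantˡ c g (suc n) = ≡.trans (cong (c 𝔽₃.* g (suc n) 𝔽₃.+_) (⊠-zeroˡ g (λ _ → ≡.refl) n)) (𝔽₃.+-identityʳ (c 𝔽₃.* g (suc n)))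

    ⊞-⊠-isCommutativeRing : IsCommutativeRing _≈_ _⊞_ _⊠_ ⊟_ (constant 0F) (constant 1F)
    ⊞-⊠-isCommutativeRing = record
      { isRing = record
        { +-isAbelianGroup = record
          { isGroup = record
            { isMonoid = record
              { isSemigroup = record
                { isMagma = record
                  { isEquivalence = record
                    { refl  = pointwise λ _ → ≡.refl
                    ; sym   = λ p → pointwise λ n → ≡.sym (coeff p n)
                    ; trans = λ p q → pointwise λ n → ≡.trans (coeff p n) (coeff q n)
                    }
                  ; ∙-cong = λ p q → pointwise λ n → cong₂ 𝔽₃._+_ (coeff p n) (coeff q n)
                  }
                ; assoc = λ f g h → pointwise λ n → 𝔽₃.+-assoc (f n) (g n) (h n)
                }
              ; identity = +-identityˡ , λ f → pointwise λ n → ≡.trans (𝔽₃.+-comm (f n) (constant 0F n)) (coeff (+-identityˡ f) n)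
              }
            ; inverse = (λ f → pointwise λ n → ≡.trans (𝔽₃.-‿inverseˡ (f n)) (≡.sym (constant0 n)))
                      , (λ f → pointwise λ n → ≡.trans (𝔽₃.+-comm (f n) (𝔽₃.- f n)) (≡.trans (𝔽₃.-‿inverseˡ (f n)) (≡.sym (constant0 n))))
            ; ⁻¹-cong = λ p → pointwise λ n → cong 𝔽₃.-_ (coeff p n)
            }
          ; comm = λ f g → pointwise λ n → 𝔽₃.+-comm (f n) (g n)
          }
        ; *-cong = ⊠-cong
        ; *-assoc = ⊠-assoc
        ; *-identity = *-identityˡ , λ f → pointwise λ n → ≡.trans (coeff (⊠-comm f (constant 1F)) n) (coeff (*-identityˡ f) n)
        ; distrib = (λ f g h → pointwise λ n → ≡.trans (coeff (⊠-comm f (g ⊞ h)) n)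
                       (≡.trans (coeff (⊠-distribʳ-⊞ f g h) n) (cong₂ 𝔽₃._+_ (coeff (⊠-comm g f) n) (coeff (⊠-comm h f) n))))
                  , ⊠-distribʳ-⊞
        }
      ; *-comm = ⊠-comm
      }
      where
      constant0 : ∀ n → constant 0F n ≡ 0F
      constant0 zero    = ≡.refl
      constant0 (suc _) = ≡.refl
      +-identityˡ : LeftIdentity _≈_ (constant 0F) _⊞_
      +-identityˡ f = pointwise λ n → cong (𝔽₃._+ f n) (constant0 n)
      *-identityˡ : LeftIdentity _≈_ (constant 1F) _⊠_
      *-identityˡ f = pointwise (⊠-constantˡ 1F f)

    constant-+ : ∀ c d → constant (c 𝔽₃.+ d) ≈ constant c ⊞ constant d
    constant-+ c d = pointwise λ { zero → ≡.refl ; (suc _) → ≡.refl }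

    constant-* : ∀ c d → constant (c 𝔽₃.* d) ≈ constant c ⊠ constant d
    constant-* c d = pointwise λ
      { zero    → ≡.refl
      ; (suc n) → ≡.sym (≡.trans (⊠-constantˡ c (constant d) (suc n)) (𝔽₃.*-zeroʳ c)) }

    constant-neg : ∀ c → constant (𝔽₃.- c) ≈ ⊟ constant c
    constant-neg c = pointwise λ { zero → ≡.refl ; (suc _) → ≡.refl }

  seriesRing : CommutativeRing 0ℓ 0ℓ
  seriesRing = record { isCommutativeRing = ⊞-⊠-isCommutativeRing }

  almostCommutativeRing : ACR.AlmostCommutativeRing 0ℓ 0ℓ
  almostCommutativeRing = ACR.fromCommutativeRing seriesRing

  𝔽₃-rawRing : RawRing 0ℓ 0ℓ
  𝔽₃-rawRing = record { Carrier = 𝔽₃ ; _≈_ = _≡_ ; _+_ = 𝔽₃._+_ ; _*_ = 𝔽₃._*_ ; -_ = 𝔽₃.-_ ; 0# = 0F ; 1# = 1F }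

  constant-morphism : 𝔽₃-rawRing ACR.-Raw-AlmostCommutative⟶ almostCommutativeRing
  constant-morphism = record
    { ⟦_⟧    = constant
    ; +-homo = constant-+
    ; *-homo = constant-*
    ; -‿homo = constant-neg
    ; 0-homo = pointwise λ _ → ≡.refl
    ; 1-homo = pointwise λ _ → ≡.refl
    }

  constant≟ : ∀ c d → Maybe (constant c ≈ constant d)
  constant≟ c d = Maybe.map (λ { ≡.refl → pointwise λ _ → ≡.refl }) (dec⇒maybe (c ≟ d))

  -- Taking 𝔽₃ as the ring of coefficients lets the solver use that 3 = 0.
  module Solver = Algebra.Solver.Ring _ almostCommutativeRing constant-morphism constant≟

  open CommutativeRing seriesRing public hiding (_≈_; zero)
  open import Algebra.Properties.CommutativeSemiring.Exp commutativeSemiring public using (_^_; ^-congˡ; ^-congʳ; ^-homo-*; ^-assocʳ; ^-distrib-*)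
  open Solver public using (solve; _:=_; _:+_; _:*_; _:-_; :-_; _:^_; con)

  module ≈-Reasoning where
    open import Relation.Binary.Reasoning.Setoid setoid public

  -- Agreement modulo powers of q, and cancellation

  infix 4 _≈[_]_

  record _≈[_]_ (f : Series) (n : ℕ) (g : Series) : Set where
    constructor below
    field coeff< : ∀ i → i < n → f i ≡ g i
  open _≈[_]_

  ≈[]-trans : ∀ {n f g h} → f ≈[ n ] g → g ≈[ n ] h → f ≈[ n ] h
  ≈[]-trans p q = below λ i i<n → ≡.trans (coeff< p i i<n) (coeff< q i i<n)

  ≈[]-sym : ∀ {n f g} → f ≈[ n ] g → g ≈[ n ] f
  ≈[]-sym p = below λ i i<n → ≡.sym (coeff< p i i<n)

  ≈⇒≈[] : ∀ {n f g} → f ≈ g → f ≈[ n ] g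
  ≈⇒≈[] p = below λ i _ → coeff p i

  ≈[]-weaken : ∀ {m n f g} → m ≤ n → f ≈[ n ] g → f ≈[ m ] g
  ≈[]-weaken m≤n p = below λ i i<m → coeff< p i (ℕ.<-≤-trans i<m m≤n)

  opaque
    unfolding _⊞_

    +-cong-≈[] : ∀ {n f f′ g g′} → f ≈[ n ] f′ → g ≈[ n ] g′ → f + g ≈[ n ] f′ + g′
    +-cong-≈[] p q = below λ i i<n → cong₂ 𝔽₃._+_ (coeff< p i i<n) (coeff< q i i<n)

    *-cong-≈[] : ∀ {n f f′ g g′} → f ≈[ n ] f′ → g ≈[ n ] g′ → f * g ≈[ n ] f′ * g′
    *-cong-≈[] p q = below λ i i<n → ⊠-cong-≤ i (λ j j≤i → coeff< p j (ℕ.≤-<-trans j≤i i<n)) (λ j j≤i → coeff< q j (ℕ.≤-<-trans j≤i i<n))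

    X*-zero : ∀ f → (X * f) 0 ≡ 0F
    X*-zero f = ≡.refl

    X*-suc : ∀ f n → (X * f) (suc n) ≡ f n
    X*-suc f n = ⊠-constantˡ 1F f n

    head-tail : ∀ f → f ≈ constant (f 0) + X * tail f
    head-tail f = pointwise λ
      { zero    → ≡.sym (𝔽₃.+-identityʳ (f 0))
      ; (suc n) → ≡.sym (X*-suc (tail f) n) }

    X*-cong-≈[] : ∀ {n f g} → f ≈[ n ] g → X * f ≈[ suc n ] X * g
    X*-cong-≈[] {f = f} {g} p = below λ
      { zero    _         → ≡.refl
      ; (suc i) (s≤s i<n) → ≡.trans (X*-suc f i) (≡.trans (coeff< p i i<n) (≡.sym (X*-suc g i))) }

    X^*-cong-≈[] : ∀ k {n f g} → f ≈[ n ] g → X ^ k * f ≈[ k ℕ.+ n ] X ^ k * g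
    X^*-cong-≈[] zero    {f = f} {g} p = ≈[]-trans (≈⇒≈[] (*-identityˡ f)) (≈[]-trans p (≈⇒≈[] (sym (*-identityˡ g))))
    X^*-cong-≈[] (suc k) {f = f} {g} p = ≈[]-trans (≈⇒≈[] (*-assoc X (X ^ k) f))
      (≈[]-trans (X*-cong-≈[] (X^*-cong-≈[] k p)) (≈⇒≈[] (sym (*-assoc X (X ^ k) g))))

    X^*≈[]0 : ∀ k f → X ^ k * f ≈[ k ] 0#
    X^*≈[]0 k f = ≈[]-trans
      (≡.subst (λ n → X ^ k * f ≈[ n ] X ^ k * 0#) (ℕ.+-identityʳ k) (X^*-cong-≈[] k {0} (below λ _ ())))
      (≈⇒≈[] (zeroʳ (X ^ k)))

    X*-cancel : ∀ {f g} → X * f ≈ X * g → f ≈ g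
    X*-cancel {f} {g} p = pointwise λ n → ≡.trans (≡.sym (X*-suc f n)) (≡.trans (coeff p (suc n)) (X*-suc g n))

    ≈[]⇒≈ : ∀ {f g} → (∀ n → f ≈[ n ] g) → f ≈ g
    ≈[]⇒≈ p = pointwise λ n → coeff< (p (suc n)) n (ℕ.n<1+n n)

    -- Stands in for division by a unit: the heads agree because u(0) = 1, and removing equal
    -- multiples of `u` leaves the same situation for the tails.
    *-cancelˡ : ∀ u {f g} → u 0 ≡ 1F → u * f ≈ u * g → f ≈ g
    *-cancelˡ u u₀ p = pointwise λ n → go _ _ (coeff p) n
      where
      go : ∀ f g → (∀ n → (u * f) n ≡ (u * g) n) → ∀ n → f n ≡ g n
      go f g p zero    = ≡.trans (≡.sym (head f)) (≡.trans (p 0) (head g))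
        where
        head : ∀ h → (u * h) 0 ≡ h 0
        head h = cong (𝔽₃._* h 0) u₀
      go f g p (suc n) = go (tail f) (tail g) tails n
        where
        tails : ∀ j → (u * tail f) j ≡ (u * tail g) j
        tails j = 𝔽₃.+-cancelʳ _ _ (u (suc j) 𝔽₃.* f 0)
          (≡.trans (≡.sym (⊠-suc u f j)) (≡.trans (p (suc j))
            (≡.trans (⊠-suc u g j) (cong (λ c → (u * tail g) j 𝔽₃.+ u (suc j) 𝔽₃.* c) (≡.sym (go f g p 0))))))

    -- Cubing as q ↦ q³, and the sections U_j

    expand₃ : Series → Series
    expand₃ f 0                   = f 0
    expand₃ f 1                   = 0F
    expand₃ f 2                   = 0F
    expand₃ f (suc (suc (suc n))) = expand₃ (tail f) n

    -- The mixed binomial terms carry a factor 3, and every constant of 𝔽₃ is its own cube.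
    cube-split : ∀ f → f ^ 3 ≈ constant (f 0) + X * (X * (X * tail f ^ 3))
    cube-split f = begin
      f ^ 3 ≈⟨ ^-congˡ 3 (head-tail f) ⟩
      (constant (f 0) + X * tail f) ^ 3
        ≈⟨ solve 3 (λ c x t → (c :+ x :* t) :^ 3 := c :^ 3 :+ x :* (x :* (x :* t :^ 3))) refl (constant (f 0)) X (tail f) ⟩
      constant (f 0) ^ 3 + X * (X * (X * tail f ^ 3)) ≈⟨ +-congʳ (constant-cube (f 0)) ⟩
      constant (f 0) + X * (X * (X * tail f ^ 3)) ∎
      where
      open ≈-Reasoning
      constant-cube : ∀ c → constant c ^ 3 ≈ constant c
      constant-cube 0F = solve 0 (con 0F :^ 3 := con 0F) refl
      constant-cube 1F = solve 0 (con 1F :^ 3 := con 1F) refl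
      constant-cube 2F = solve 0 (con 2F :^ 3 := con 2F) refl

    frobenius : ∀ f → f ^ 3 ≈ expand₃ f
    frobenius f = pointwise (go f)
      where
      go : ∀ f n → (f ^ 3) n ≡ expand₃ f n
      go f n = ≡.trans (coeff (cube-split f) n) (split n)
        where
        t³ : Series
        t³ = tail f ^ 3
        split : ∀ n → (constant (f 0) + X * (X * (X * t³))) n ≡ expand₃ f n
        split 0 = 𝔽₃.+-identityʳ (f 0)
        split 1 = X*-suc (X * (X * t³)) 0
        split 2 = ≡.trans (X*-suc (X * (X * t³)) 1) (X*-suc (X * t³) 0)
        split (suc (suc (suc n))) = ≡.trans (X*-suc (X * (X * t³)) (2 ℕ.+ n))
          (≡.trans (X*-suc (X * t³) (1 ℕ.+ n)) (≡.trans (X*-suc t³ n) (go (tail f) n)))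

    U : ℕ → Series → Series
    U j f n = f (n ℕ.* 3 ℕ.+ j)

    U-cong : ∀ j {f g} → f ≈ g → U j f ≈ U j g
    U-cong j p = pointwise λ n → coeff p (n ℕ.* 3 ℕ.+ j)

    U-+ : ∀ j f g → U j (f + g) ≈ U j f + U j g
    U-+ j f g = refl

    U-neg : ∀ j f → U j (- f) ≈ - U j f
    U-neg j f = refl

    -- A series in q³ preserves residue classes of exponents modulo 3. The bound on `j` matters at
    -- `n` = 0, where a larger `j` would let a further coefficient of `a` contribute.
    U-expand₃ : ∀ j → j < 3 → ∀ a f n → (expand₃ a * f) (n ℕ.* 3 ℕ.+ j) ≡ (a * U j f) n
    U-expand₃ 0 _ a f zero = ≡.refl
    U-expand₃ 1 _ a f zero = 𝔽₃.+-identityʳ (a 0 𝔽₃.* f 1)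
    U-expand₃ 2 _ a f zero = 𝔽₃.+-identityʳ (a 0 𝔽₃.* f 2)
    U-expand₃ (suc (suc (suc _))) (s≤s (s≤s (s≤s ()))) a f zero
    U-expand₃ j j<3 a f (suc n) = cong (a 0 𝔽₃.* f (3 ℕ.+ (n ℕ.* 3 ℕ.+ j)) 𝔽₃.+_) (U-expand₃ j j<3 (tail a) f n)

    U-cube : ∀ j → j < 3 → ∀ a f → U j (a ^ 3 * f) ≈ a * U j f
    U-cube j j<3 a f = trans (U-cong j (*-congʳ (frobenius a))) (pointwise (U-expand₃ j j<3 a f))

    -- Exponent 3n in the product comes from 3(n - 1) + 2 in `f`; the lost step reappears as the
    -- factor `X`.
    U₀-X : ∀ f → U 0 (X * f) ≈ X * U 2 f
    U₀-X f = pointwise λ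
      { zero    → ≡.refl
      ; (suc n) → ≡.trans (X*-suc f (2 ℕ.+ (n ℕ.* 3 ℕ.+ 0)))
         (≡.trans (cong f (≡.trans (cong (2 ℕ.+_) (ℕ.+-identityʳ (n ℕ.* 3))) (ℕ.+-comm 2 (n ℕ.* 3)))) (≡.sym (X*-suc (U 2 f) n))) }

    U-suc-X : ∀ j f → U (suc j) (X * f) ≈ U j f
    U-suc-X j f = pointwise λ n → ≡.trans (cong (X * f) (ℕ.+-suc (n ℕ.* 3) j)) (X*-suc f (n ℕ.* 3 ℕ.+ j))

    U-injective : ∀ {f g} → U 0 f ≈ U 0 g → U 1 f ≈ U 1 g → U 2 f ≈ U 2 g → f ≈ g
    U-injective p₀ p₁ p₂ = pointwise (go p₀ p₁ p₂)
      where
      drop : ∀ j f g → U j f ≈ U j g → U j (tail (tail (tail f))) ≈ U j (tail (tail (tail g)))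
      drop j f g p = pointwise λ n → coeff p (suc n)
      go : ∀ {f g} → U 0 f ≈ U 0 g → U 1 f ≈ U 1 g → U 2 f ≈ U 2 g → ∀ n → f n ≡ g n
      go p₀ p₁ p₂ 0 = coeff p₀ 0
      go p₀ p₁ p₂ 1 = coeff p₁ 0
      go p₀ p₁ p₂ 2 = coeff p₂ 0
      go {f} {g} p₀ p₁ p₂ (suc (suc (suc n))) = go {tail (tail (tail f))} {tail (tail (tail g))} (drop 0 f g p₀) (drop 1 f g p₁) (drop 2 f g p₂) n

    U₀-1 : U 0 1# ≈ 1#
    U₀-1 = pointwise λ { zero → ≡.refl ; (suc _) → ≡.refl }

    U₁-1 : U 1 1# ≈ 0#
    U₁-1 = pointwise λ { zero → ≡.refl ; (suc _) → ≡.refl }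

    U₂-1 : U 2 1# ≈ 0#
    U₂-1 = pointwise λ { zero → ≡.refl ; (suc _) → ≡.refl }

  0<3 : 0 < 3
  0<3 = s≤s z≤n

  1<3 : 1 < 3
  1<3 = s≤s (s≤s z≤n)

  2<3 : 2 < 3
  2<3 = s≤s (s≤s (s≤s z≤n))

  U-cube-1 : ∀ j → j < 3 → ∀ a → U j (a ^ 3) ≈ a * U j 1#
  U-cube-1 j j<3 a = trans (U-cong j (sym (*-identityʳ (a ^ 3)))) (U-cube j j<3 a 1#)

  module _ (a b c : Series) where

    private
      f = a ^ 3 + X * b ^ 3 + X * (X * c ^ 3)

    -- Cubes are series in q³, so a sum of this shape already displays its 3-dissection, and the
    -- cube roots can be read off.
    U₀-sections : U 0 f ≈ a
    U₀-sections = begin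
      U 0 f
        ≈⟨ trans (U-+ 0 (a ^ 3 + X * b ^ 3) (X * (X * c ^ 3))) (+-congʳ (U-+ 0 (a ^ 3) (X * b ^ 3))) ⟩
      U 0 (a ^ 3) + U 0 (X * b ^ 3) + U 0 (X * (X * c ^ 3))
        ≈⟨ +-cong (+-cong (U-cube-1 0 0<3 a) (trans (U₀-X (b ^ 3)) (*-congˡ (U-cube-1 2 2<3 b))))
             (trans (U₀-X (X * c ^ 3)) (*-congˡ (trans (U-suc-X 1 (c ^ 3)) (U-cube-1 1 1<3 c)))) ⟩
      a * U 0 1# + X * (b * U 2 1#) + X * (c * U 1 1#)
        ≈⟨ +-cong (+-cong (*-congˡ U₀-1) (*-congˡ (*-congˡ U₂-1))) (*-congˡ (*-congˡ U₁-1)) ⟩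
      a * 1# + X * (b * 0#) + X * (c * 0#)
        ≈⟨ solve 4 (λ x a b c → a :* con 1F :+ x :* (b :* con 0F) :+ x :* (c :* con 0F) := a) refl X a b c ⟩
      a ∎
      where open ≈-Reasoning

    U₁-sections : U 1 f ≈ b
    U₁-sections = begin
      U 1 f
        ≈⟨ trans (U-+ 1 (a ^ 3 + X * b ^ 3) (X * (X * c ^ 3))) (+-congʳ (U-+ 1 (a ^ 3) (X * b ^ 3))) ⟩
      U 1 (a ^ 3) + U 1 (X * b ^ 3) + U 1 (X * (X * c ^ 3))
        ≈⟨ +-cong (+-cong (U-cube-1 1 1<3 a) (trans (U-suc-X 0 (b ^ 3)) (U-cube-1 0 0<3 b)))
             (trans (U-suc-X 0 (X * c ^ 3)) (trans (U₀-X (c ^ 3)) (*-congˡ (U-cube-1 2 2<3 c)))) ⟩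
      a * U 1 1# + b * U 0 1# + X * (c * U 2 1#)
        ≈⟨ +-cong (+-cong (*-congˡ U₁-1) (*-congˡ U₀-1)) (*-congˡ (*-congˡ U₂-1)) ⟩
      a * 0# + b * 1# + X * (c * 0#)
        ≈⟨ solve 4 (λ x a b c → a :* con 0F :+ b :* con 1F :+ x :* (c :* con 0F) := b) refl X a b c ⟩
      b ∎
      where open ≈-Reasoning

    U₂-sections : U 2 f ≈ c
    U₂-sections = begin
      U 2 f
        ≈⟨ trans (U-+ 2 (a ^ 3 + X * b ^ 3) (X * (X * c ^ 3))) (+-congʳ (U-+ 2 (a ^ 3) (X * b ^ 3))) ⟩
      U 2 (a ^ 3) + U 2 (X * b ^ 3) + U 2 (X * (X * c ^ 3))
        ≈⟨ +-cong (+-cong (U-cube-1 2 2<3 a) (trans (U-suc-X 1 (b ^ 3)) (U-cube-1 1 1<3 b)))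
             (trans (U-suc-X 1 (X * c ^ 3)) (trans (U-suc-X 0 (c ^ 3)) (U-cube-1 0 0<3 c))) ⟩
      a * U 2 1# + b * U 1 1# + c * U 0 1#
        ≈⟨ +-cong (+-cong (*-congˡ U₂-1) (*-congˡ U₁-1)) (*-congˡ U₀-1) ⟩
      a * 0# + b * 0# + c * 1#
        ≈⟨ solve 3 (λ a b c → a :* con 0F :+ b :* con 0F :+ c :* con 1F := c) refl a b c ⟩
      c ∎
      where open ≈-Reasoning

  sections : ∀ f → f ≈ U 0 f ^ 3 + X * U 1 f ^ 3 + X * (X * U 2 f ^ 3)
  sections f = U-injective (sym (U₀-sections _ _ _)) (sym (U₁-sections _ _ _)) (sym (U₂-sections _ _ _))

  -- The substitution q ↦ q², and tools for equations

  expand₂ : Series → Series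
  expand₂ f 0             = f 0
  expand₂ f 1             = 0F
  expand₂ f (suc (suc n)) = expand₂ (tail f) n

  opaque
    unfolding U

    expand₂-cong-≤ : ∀ {f g} n → (∀ i → i ≤ n → f i ≡ g i) → expand₂ f n ≡ expand₂ g n
    expand₂-cong-≤ 0 p = p 0 z≤n
    expand₂-cong-≤ 1 p = ≡.refl
    expand₂-cong-≤ (suc (suc n)) p = expand₂-cong-≤ n (λ i i≤n → p (suc i) (s≤s (ℕ.m≤n⇒m≤1+n i≤n)))

    expand₂-cong : ∀ {f g} → f ≈ g → expand₂ f ≈ expand₂ g
    expand₂-cong p = pointwise λ n → expand₂-cong-≤ n λ i _ → coeff p i

    expand₂-+ : ∀ f g → expand₂ (f + g) ≈ expand₂ f + expand₂ g
    expand₂-+ f g = pointwise (go f g)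
      where
      go : ∀ f g n → expand₂ (f + g) n ≡ expand₂ f n 𝔽₃.+ expand₂ g n
      go f g 0             = ≡.refl
      go f g 1             = ≡.refl
      go f g (suc (suc n)) = go (tail f) (tail g) n

    expand₂-· : ∀ c f n → expand₂ (c · f) n ≡ c 𝔽₃.* expand₂ f n
    expand₂-· c f 0             = ≡.refl
    expand₂-· c f 1             = ≡.sym (𝔽₃.*-zeroʳ c)
    expand₂-· c f (suc (suc n)) = expand₂-· c (tail f) n

    expand₂-* : ∀ f g → expand₂ (f * g) ≈ expand₂ f * expand₂ g
    expand₂-* f g = pointwise (go f)
      where
      go : ∀ f n → expand₂ (f * g) n ≡ (expand₂ f * expand₂ g) n
      go f 0             = ≡.refl
      go f 1             = ≡.sym (≡.trans (𝔽₃.+-identityʳ (f 0 𝔽₃.* 0F)) (𝔽₃.*-zeroʳ (f 0)))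
      go f (suc (suc n)) = ≡.trans (coeff (expand₂-+ (f 0 · tail g) (tail f * g)) n)
        (cong₂ 𝔽₃._+_ (expand₂-· (f 0) (tail g) n) (go (tail f) n))

    expand₂-constant : ∀ c → expand₂ (constant c) ≈ constant c
    expand₂-constant c = pointwise λ { 0 → ≡.refl ; 1 → ≡.refl ; (suc (suc n)) → zeros n }
      where
      zeros : ∀ n → expand₂ (λ _ → 0F) n ≡ 0F
      zeros 0 = ≡.refl
      zeros 1 = ≡.refl
      zeros (suc (suc n)) = zeros n

    expand₂-X : expand₂ X ≈ X ^ 2
    expand₂-X = pointwise λ
      { 0 → ≡.refl
      ; 1 → ≡.refl
      ; (suc (suc n)) → ≡.sym (≡.trans (X*-suc (X * 1#) (suc n)) (≡.trans (X*-suc 1# n) (≡.sym (coeff (expand₂-constant 1F) n)))) }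

    expand₂-^ : ∀ f n → expand₂ (f ^ n) ≈ expand₂ f ^ n
    expand₂-^ f zero    = expand₂-constant 1F
    expand₂-^ f (suc n) = trans (expand₂-* f (f ^ n)) (*-congˡ (expand₂-^ f n))

  opaque
    unfolding _⊞_

    1-* : ∀ {f g} → f 0 ≡ 1F → g 0 ≡ 1F → (f * g) 0 ≡ 1F
    1-* p q = cong₂ 𝔽₃._*_ p q

    1-X* : ∀ {f g} → f 0 ≡ 1F → (f - X * g) 0 ≡ 1F
    1-X* {f} p = ≡.trans (𝔽₃.+-identityʳ (f 0)) p

    1-neg-+ : ∀ {f g} → f 0 ≡ 1F → g 0 ≡ 1F → (- (f + g)) 0 ≡ 1F
    1-neg-+ p q = cong₂ (λ c d → 𝔽₃.- (c 𝔽₃.+ d)) p q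

  -- `U 0` is a left inverse of cubing.
  cube-injective : ∀ {f g} → f ^ 3 ≈ g ^ 3 → f ≈ g
  cube-injective {f} {g} p = trans (sym (U₀-cube f)) (trans (U-cong 0 p) (U₀-cube g))
    where
    U₀-cube : ∀ f → U 0 (f ^ 3) ≈ f
    U₀-cube f = trans (U-cube-1 0 0<3 f) (trans (*-congˡ U₀-1) (*-identityʳ f))

  1-^ : ∀ {f} n → f 0 ≡ 1F → (f ^ n) 0 ≡ 1F
  1-^ zero    p = ≡.refl
  1-^ {f} (suc n) p = 1-* {f} {f ^ n} p (1-^ {f} n p)

  difference⇒≈ : ∀ {f g} → f - g ≈ 0# → f ≈ g
  difference⇒≈ {f} {g} p = begin
    f         ≈⟨ solve 2 (λ f g → f := (f :- g) :+ g) refl f g ⟩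
    (f - g) + g ≈⟨ +-congʳ p ⟩
    0# + g    ≈⟨ +-identityˡ g ⟩
    g         ∎
    where open ≈-Reasoning

  ≈⇒difference : ∀ {f g} → f ≈ g → f - g ≈ 0#
  ≈⇒difference {f} {g} p = trans (+-congʳ p) (-‿inverseʳ g)

  -- The multiplier `c` is a certificate: that `L - R` equals this multiple of a known relation is a
  -- ring identity, left to the solver. `linear₂` does the same with two relations.
  linear₁ : ∀ c {l r L R} → l ≈ r → L - R ≈ c * (l - r) → L ≈ R
  linear₁ c p e = difference⇒≈ (trans e (trans (*-congˡ (≈⇒difference p)) (zeroʳ c)))

  linear₂ : ∀ c d {l r m s L R} → l ≈ r → m ≈ s → L - R ≈ c * (l - r) + d * (m - s) → L ≈ R
  linear₂ c d p q e = difference⇒≈ (trans e (trans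
    (+-cong (trans (*-congˡ (≈⇒difference p)) (zeroʳ c)) (trans (*-congˡ (≈⇒difference q)) (zeroʳ d))) (+-identityˡ 0#)))

  neg-swap : ∀ {f g} → g ≈ - f → f ≈ - g
  neg-swap {f} {g} p = linear₁ 1# p (solve 2 (λ f g → f :- (:- g) := con 1F :* (g :- (:- f))) refl f g)

  -- Convergence in the q-adic topology

  infix 4 _⟶_

  record _⟶_ (F : ℕ → Series) (f : Series) : Set where
    constructor converges
    field eventually : ∀ N → ∃ λ M → ∀ m → M ≤ m → F m ≈[ N ] f
  open _⟶_

  -- Agreement modulo `X ^ n` at stage `n` is enough, which leaves room for the error terms of
  -- finite forms of product identities.
  ⟶-unique : ∀ {F G f g} → F ⟶ f → G ⟶ g → (∀ n → F n ≈[ n ] G n) → f ≈ g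
  ⟶-unique {F} {G} {f} {g} p q F≈G = ≈[]⇒≈ at
    where
    at : ∀ N → f ≈[ N ] g
    at N with eventually p N | eventually q N
    ... | M₁ , F≈f | M₂ , G≈g = ≈[]-trans (≈[]-sym (F≈f m (ℕ.≤-trans (ℕ.m≤m+n M₁ M₂) (ℕ.m≤m+n (M₁ ℕ.+ M₂) N))))
      (≈[]-trans (≈[]-weaken (ℕ.m≤n+m N (M₁ ℕ.+ M₂)) (F≈G m)) (G≈g m (ℕ.≤-trans (ℕ.m≤n+m M₂ M₁) (ℕ.m≤m+n (M₁ ℕ.+ M₂) N))))
      where m = M₁ ℕ.+ M₂ ℕ.+ N

  ⟶-resp : ∀ {F G f} → F ⟶ f → (∀ n → F n ≈ G n) → G ⟶ f
  ⟶-resp p F≈G = converges λ N → let M , F≈f = eventually p N in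
    M , λ m M≤m → ≈[]-trans (≈⇒≈[] (sym (F≈G m))) (F≈f m M≤m)

  ⟶-* : ∀ {F G f g} → F ⟶ f → G ⟶ g → (λ n → F n * G n) ⟶ f * g
  ⟶-* p q = converges λ N → let M₁ , F≈f = eventually p N ; M₂ , G≈g = eventually q N in
    M₁ ℕ.+ M₂ , λ m M≤m → *-cong-≈[] (F≈f m (ℕ.≤-trans (ℕ.m≤m+n M₁ M₂) M≤m)) (G≈g m (ℕ.≤-trans (ℕ.m≤n+m M₂ M₁) M≤m))

  ⟶-1# : (λ _ → 1#) ⟶ 1#
  ⟶-1# = converges λ N → 0 , λ _ _ → ≈⇒≈[] refl

  ⟶-^ : ∀ {F f} → F ⟶ f → ∀ k → (λ n → F n ^ k) ⟶ f ^ k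
  ⟶-^ p zero    = ⟶-1#
  ⟶-^ p (suc k) = ⟶-* p (⟶-^ p k)

  ⟶-subsequence : ∀ {F f} → F ⟶ f → (s : ℕ → ℕ) → (∀ n → n ≤ s n) → (λ n → F (s n)) ⟶ f
  ⟶-subsequence p s n≤s = converges λ N → let M , F≈f = eventually p N in
    M , λ m M≤m → F≈f (s m) (ℕ.≤-trans M≤m (n≤s m))

  ⟶-expand₂ : ∀ {F f} → F ⟶ f → (λ n → expand₂ (F n)) ⟶ expand₂ f
  ⟶-expand₂ p = converges λ N → let M , F≈f = eventually p N in
    M , λ m M≤m → below λ i i<N → expand₂-cong-≤ i λ j j≤i → coeff< (F≈f m M≤m) j (ℕ.≤-<-trans j≤i i<N)

  opaque
    unfolding U

    ⟶-U : ∀ j {F f} → F ⟶ f → (λ n → U j (F n)) ⟶ U j f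
    ⟶-U j p = converges λ N → let M , F≈f = eventually p (N ℕ.* 3 ℕ.+ j) in
      M , λ m M≤m → below λ i i<N → coeff< (F≈f m M≤m) (i ℕ.* 3 ℕ.+ j) (ℕ.+-monoˡ-< j (ℕ.*-monoˡ-< 3 i<N))

  -- Coefficient `n` is read at stage `suc n`, from which on it is stable once `F (suc m)` and `F m`
  -- agree below `m` for every `m`.
  limit : (ℕ → Series) → Series
  limit F n = F (suc n) n

  limit-converges : ∀ F → (∀ n → F (suc n) ≈[ n ] F n) → F ⟶ limit F
  limit-converges F cauchy = converges λ N → N , λ m N≤m → below λ i i<N → stable i m (ℕ.≤-trans i<N N≤m)
    where
    stable : ∀ i m → i < m → F m i ≡ F (suc i) i
    stable i (suc m) (s≤s i≤m) with ℕ.m≤n⇒m<n∨m≡n i≤m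
    ... | inj₂ ≡.refl = ≡.refl
    ... | inj₁ i<m    = ≡.trans (coeff< (cauchy m) i i<m) (stable i m i<m)

-- Infinite products and Shanks' sums

module QSeries where

  open PowerSeries

  -- The q-Pochhammer symbol (a; ρ)ₙ.
  poch : Series → Series → ℕ → Series
  poch ρ a zero    = 1#
  poch ρ a (suc n) = poch ρ a n * (1# - ρ ^ n * a)

  poch-cong : ∀ {ρ ρ′ a a′} n → ρ ≈ ρ′ → a ≈ a′ → poch ρ a n ≈ poch ρ′ a′ n
  poch-cong zero    p q = refl
  poch-cong (suc n) p q = *-cong (poch-cong n p q) (+-congˡ (-‿cong (*-cong (^-congˡ n p) q)))

  poch-suc : ∀ ρ a n → poch ρ a (suc n) ≈ (1# - a) * poch ρ (ρ * a) n
  poch-suc ρ a zero    = solve 1 (λ a → con 1F :* (con 1F :- con 1F :* a) := (con 1F :- a) :* con 1F) refl a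
  poch-suc ρ a (suc n) = begin
    poch ρ a (suc n) * (1# - ρ * ρ ^ n * a)                ≈⟨ *-congʳ (poch-suc ρ a n) ⟩
    (1# - a) * poch ρ (ρ * a) n * (1# - ρ * ρ ^ n * a)
      ≈⟨ solve 4 (λ a ρ r p → (con 1F :- a) :* p :* (con 1F :- ρ :* r :* a) := (con 1F :- a) :* (p :* (con 1F :- r :* (ρ :* a)))) refl a ρ (ρ ^ n) (poch ρ (ρ * a) n) ⟩
    (1# - a) * (poch ρ (ρ * a) n * (1# - ρ ^ n * (ρ * a))) ∎
    where open ≈-Reasoning

  -- Divisibility of `ρ` by q makes the factor number `n` congruent to 1 modulo `X ^ n`; `ρ′` is the
  -- cofactor.
  poch-converges : ∀ {ρ} ρ′ a → ρ ≈ X * ρ′ → poch ρ a ⟶ limit (poch ρ a)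
  poch-converges {ρ} ρ′ a ρ≈ = limit-converges (poch ρ a) λ n → ≈[]-trans (≈⇒≈[] (step n))
    (≈[]-trans (+-cong-≈[] (≈⇒≈[] refl) (X^*≈[]0 n (- (ρ′ ^ n * a * poch ρ a n)))) (≈⇒≈[] (+-identityʳ (poch ρ a n))))
    where
    step : ∀ n → poch ρ a (suc n) ≈ poch ρ a n + X ^ n * - (ρ′ ^ n * a * poch ρ a n)
    step n = begin
      poch ρ a n * (1# - ρ ^ n * a)              ≈⟨ *-congˡ (+-congˡ (-‿cong (*-congʳ (trans (^-congˡ n ρ≈) (^-distrib-* X ρ′ n))))) ⟩
      poch ρ a n * (1# - X ^ n * ρ′ ^ n * a)
        ≈⟨ solve 4 (λ p x r a → p :* (con 1F :- x :* r :* a) := p :+ x :* (:- (r :* a :* p))) refl (poch ρ a n) (X ^ n) (ρ′ ^ n) a ⟩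
      poch ρ a n + X ^ n * - (ρ′ ^ n * a * poch ρ a n) ∎
      where open ≈-Reasoning

  ^-swap : ∀ f m n → (f ^ m) ^ n ≈ (f ^ n) ^ m
  ^-swap f m n = trans (^-assocʳ f m n) (trans (^-congʳ f (ℕ.*-comm m n)) (sym (^-assocʳ f n m)))

  poch-squares : ∀ ρ a n → poch ρ a n * poch ρ (- a) n ≈ poch (ρ ^ 2) (a ^ 2) n
  poch-squares ρ a zero    = *-identityˡ 1#
  poch-squares ρ a (suc n) = begin
    poch ρ a n * (1# - ρ ^ n * a) * (poch ρ (- a) n * (1# - ρ ^ n * - a))
      ≈⟨ solve 4 (λ p q r a → p :* (con 1F :- r :* a) :* (q :* (con 1F :- r :* (:- a))) := p :* q :* (con 1F :- r :^ 2 :* a :^ 2)) refl (poch ρ a n) (poch ρ (- a) n) (ρ ^ n) a ⟩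
    poch ρ a n * poch ρ (- a) n * (1# - (ρ ^ n) ^ 2 * a ^ 2)   ≈⟨ *-cong (poch-squares ρ a n) (+-congˡ (-‿cong (*-congʳ (^-swap ρ n 2)))) ⟩
    poch (ρ ^ 2) (a ^ 2) n * (1# - (ρ ^ 2) ^ n * a ^ 2)        ∎
    where open ≈-Reasoning

  poch-even-odd : ∀ ρ a n → poch ρ a (n ℕ.* 2) ≈ poch (ρ ^ 2) a n * poch (ρ ^ 2) (ρ * a) n
  poch-even-odd ρ a zero    = sym (*-identityˡ 1#)
  poch-even-odd ρ a (suc n) = begin
    poch ρ a (n ℕ.* 2) * (1# - ρ ^ (n ℕ.* 2) * a) * (1# - ρ * ρ ^ (n ℕ.* 2) * a)
      ≈⟨ *-cong (*-cong (poch-even-odd ρ a n) (+-congˡ (-‿cong (*-congʳ ρ^2n)))) (+-congˡ (-‿cong (*-congʳ (*-congˡ ρ^2n)))) ⟩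
    poch (ρ ^ 2) a n * poch (ρ ^ 2) (ρ * a) n * (1# - (ρ ^ 2) ^ n * a) * (1# - ρ * (ρ ^ 2) ^ n * a)
      ≈⟨ solve 5 (λ p q r ρ a → p :* q :* (con 1F :- r :* a) :* (con 1F :- ρ :* r :* a) := p :* (con 1F :- r :* a) :* (q :* (con 1F :- r :* (ρ :* a))))
           refl (poch (ρ ^ 2) a n) (poch (ρ ^ 2) (ρ * a) n) ((ρ ^ 2) ^ n) ρ a ⟩
    poch (ρ ^ 2) a n * (1# - (ρ ^ 2) ^ n * a) * (poch (ρ ^ 2) (ρ * a) n * (1# - (ρ ^ 2) ^ n * (ρ * a))) ∎
    where
    open ≈-Reasoning
    ρ^2n : ρ ^ (n ℕ.* 2) ≈ (ρ ^ 2) ^ n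
    ρ^2n = trans (sym (^-assocʳ ρ n 2)) (^-swap ρ n 2)

  expand₂-neg : ∀ f → expand₂ (- f) ≈ - expand₂ f
  expand₂-neg f = linear₁ 1# (trans (sym (expand₂-+ (- f) f)) (trans (expand₂-cong (-‿inverseˡ f)) (expand₂-constant 0F)))
    (solve 2 (λ e g → e :- (:- g) := con 1F :* (e :+ g :- con 0F)) refl (expand₂ (- f)) (expand₂ f))

  expand₂-poch : ∀ ρ a n → expand₂ (poch ρ a n) ≈ poch (expand₂ ρ) (expand₂ a) n
  expand₂-poch ρ a zero    = expand₂-constant 1F
  expand₂-poch ρ a (suc n) = trans (expand₂-* (poch ρ a n) (1# - ρ ^ n * a)) (*-cong (expand₂-poch ρ a n)
    (trans (expand₂-+ 1# (- (ρ ^ n * a))) (+-cong (expand₂-constant 1F) (trans (expand₂-neg (ρ ^ n * a))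
      (-‿cong (trans (expand₂-* (ρ ^ n) a) (*-congʳ (expand₂-^ ρ n))))))))

  -- Shanks' telescoping proof of Gauss's identities ("Two theorems of Gauss", 1958), with both theta
  -- functions as instances.  R 1 Q n is the sum over s ≤ n of (a; ρ)ₛ (ρˢ⁺¹; ρ)ₙ₋ₛ Qˢ, in Horner form.
  module Shanks (ρ a : Series) where

    R : Series → Series → ℕ → Series
    R p Q zero    = 1#
    R p Q (suc d) = poch ρ (ρ * p) (suc d) + (1# - a * p) * Q * R (ρ * p) Q d

    R-cong : ∀ p {Q Q′} d → Q ≈ Q′ → R p Q d ≈ R p Q′ d
    R-cong p zero    Q≈Q′ = refl
    R-cong p (suc d) Q≈Q′ = +-congˡ (*-cong (*-congˡ Q≈Q′) (R-cong (ρ * p) d Q≈Q′))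

    -- Isolates the term s = 0. When `Q` is a high power of q, everything else disappears in the
    -- limit.
    R-head : ∀ p Q d → ∃ λ r → R p Q d ≈ poch ρ (ρ * p) d + Q * r
    R-head p Q zero    = 0# , sym (trans (+-congˡ (zeroʳ Q)) (+-identityʳ 1#))
    R-head p Q (suc d) = (1# - a * p) * R (ρ * p) Q d ,
      +-congˡ (solve 3 (λ s q r → s :* q :* r := q :* (s :* r)) refl (1# - a * p) Q (R (ρ * p) Q d))

    -- Comparing the ratios `Q` and `ρ * Q` makes the sum telescope, so only its two boundary terms
    -- remain. At `p` = 1 the lower one vanishes through its factor `1# - p`.
    R-telescope : ∀ p Q d → (1# - a * Q) * p * R p (ρ * Q) d - (1# - Q) * R p Q d
                          ≈ poch ρ (a * p) (suc d) * Q ^ suc d - (1# - p) * poch ρ (ρ * p) d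
    R-telescope p Q zero    = solve 3 (λ a p q → (con 1F :- a :* q) :* p :* con 1F :- (con 1F :- q) :* con 1F
      := con 1F :* (con 1F :- con 1F :* (a :* p)) :* (q :* con 1F) :- (con 1F :- p) :* con 1F) refl a p Q
    R-telescope p Q (suc d) = begin
      (1# - a * Q) * p * (poch ρ (ρ * p) (suc d) + (1# - a * p) * (ρ * Q) * R₂) - (1# - Q) * (poch ρ (ρ * p) (suc d) + (1# - a * p) * Q * R₁)
        ≈⟨ +-cong (*-congˡ (+-congʳ (poch-suc ρ (ρ * p) d))) (-‿cong (*-congˡ (+-congʳ (poch-suc ρ (ρ * p) d)))) ⟩
      (1# - a * Q) * p * ((1# - ρ * p) * E + (1# - a * p) * (ρ * Q) * R₂) - (1# - Q) * ((1# - ρ * p) * E + (1# - a * p) * Q * R₁)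
        ≈⟨ linear₁ ((1# - a * p) * Q) (R-telescope (ρ * p) Q d)
             (solve 9 (λ ρ a p Q E R₁ R₂ H S →
               (con 1F :- a :* Q) :* p :* ((con 1F :- ρ :* p) :* E :+ (con 1F :- a :* p) :* (ρ :* Q) :* R₂) :- (con 1F :- Q) :* ((con 1F :- ρ :* p) :* E :+ (con 1F :- a :* p) :* Q :* R₁)
                 :- ((con 1F :- a :* p) :* H :* (Q :* S) :- (con 1F :- p) :* ((con 1F :- ρ :* p) :* E))
               := (con 1F :- a :* p) :* Q :* ((con 1F :- a :* Q) :* (ρ :* p) :* R₂ :- (con 1F :- Q) :* R₁ :- (H :* S :- (con 1F :- ρ :* p) :* E)))
               refl ρ a p Q E R₁ R₂ (poch ρ (a * (ρ * p)) (suc d)) (Q ^ suc d)) ⟩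
      (1# - a * p) * poch ρ (a * (ρ * p)) (suc d) * (Q * Q ^ suc d) - (1# - p) * ((1# - ρ * p) * E)
        ≈⟨ +-cong (*-congʳ (trans (*-congˡ (poch-cong (suc d) refl (solve 3 (λ a ρ p → a :* (ρ :* p) := ρ :* (a :* p)) refl a ρ p))) (sym (poch-suc ρ (a * p) (suc d)))))
             (-‿cong (*-congˡ (sym (poch-suc ρ (ρ * p) d)))) ⟩
      poch ρ (a * p) (suc (suc d)) * (Q * Q ^ suc d) - (1# - p) * poch ρ (ρ * p) (suc d) ∎
      where
      open ≈-Reasoning
      R₁ = R (ρ * p) Q d
      R₂ = R (ρ * p) (ρ * Q) d
      E  = poch ρ (ρ * (ρ * p)) d

    -- When the upper limit grows by one, each old summand gains the same last factor, and one new
    -- top summand appears.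
    R-extend : ∀ p Q d → R p Q (suc d) ≈ (1# - ρ ^ suc d * p) * R p Q d + poch ρ (a * p) (suc d) * Q ^ suc d
    R-extend p Q zero    = solve 4 (λ ρ a p q → con 1F :* (con 1F :- con 1F :* (ρ :* p)) :+ (con 1F :- a :* p) :* q :* con 1F
      := (con 1F :- ρ :* con 1F :* p) :* con 1F :+ con 1F :* (con 1F :- con 1F :* (a :* p)) :* (q :* con 1F)) refl ρ a p Q
    R-extend p Q (suc d) = begin
      P * (1# - ρ ^ suc d * (ρ * p)) + (1# - a * p) * Q * R (ρ * p) Q (suc d)
        ≈⟨ +-congˡ (*-congˡ (R-extend (ρ * p) Q d)) ⟩
      P * (1# - ρ ^ suc d * (ρ * p)) + (1# - a * p) * Q * ((1# - ρ ^ suc d * (ρ * p)) * R′ + poch ρ (a * (ρ * p)) (suc d) * Q ^ suc d)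
        ≈⟨ solve 9 (λ ρ a p q r P R′ H S → P :* (con 1F :- r :* (ρ :* p)) :+ (con 1F :- a :* p) :* q :* ((con 1F :- r :* (ρ :* p)) :* R′ :+ H :* S)
             := (con 1F :- ρ :* r :* p) :* (P :+ (con 1F :- a :* p) :* q :* R′) :+ (con 1F :- a :* p) :* H :* (q :* S)) refl ρ a p Q (ρ ^ suc d) P R′ (poch ρ (a * (ρ * p)) (suc d)) (Q ^ suc d) ⟩
      (1# - ρ * ρ ^ suc d * p) * (P + (1# - a * p) * Q * R′) + (1# - a * p) * poch ρ (a * (ρ * p)) (suc d) * (Q * Q ^ suc d)
        ≈⟨ +-congˡ (*-congʳ (trans (*-congˡ (poch-cong (suc d) refl (solve 3 (λ a ρ p → a :* (ρ :* p) := ρ :* (a :* p)) refl a ρ p))) (sym (poch-suc ρ (a * p) (suc d))))) ⟩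
      (1# - ρ * ρ ^ suc d * p) * R p Q (suc d) + poch ρ (a * p) (suc (suc d)) * (Q * Q ^ suc d) ∎
      where
      open ≈-Reasoning
      P  = poch ρ (ρ * p) (suc d)
      R′ = R (ρ * p) Q d

    -- The hypothesis selects the `Q` for which the factor 1 - ρⁿ⁺¹ produced by `R-extend` is the 1
    -- - aQ of `R-telescope`. Both top terms then survive, and they are the next two terms of the
    -- theta series.
    R-step : ∀ Q n → a * Q ≈ ρ ^ suc n → R 1# (ρ * Q) (suc n) ≈ (1# - Q) * R 1# Q n + poch ρ a (suc n) * (Q ^ suc n + (ρ * Q) ^ suc n)
    R-step Q n aQ≈ρ = begin
      R 1# (ρ * Q) (suc n)   ≈⟨ R-extend 1# (ρ * Q) n ⟩
      (1# - ρ ^ suc n * 1#) * R 1# (ρ * Q) n + poch ρ (a * 1#) (suc n) * (ρ * Q) ^ suc n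
        ≈⟨ +-congʳ (*-congʳ (+-congˡ (-‿cong (*-congʳ (sym aQ≈ρ))))) ⟩
      (1# - a * Q * 1#) * R 1# (ρ * Q) n + poch ρ (a * 1#) (suc n) * (ρ * Q) ^ suc n
        ≈⟨ linear₁ 1# (R-telescope 1# Q n) (solve 8 (λ a q s t R₁ R₂ H E →
             (con 1F :- a :* q :* con 1F) :* R₂ :+ H :* t :- ((con 1F :- q) :* R₁ :+ H :* (s :+ t))
             := con 1F :* ((con 1F :- a :* q) :* con 1F :* R₂ :- (con 1F :- q) :* R₁ :- (H :* s :- (con 1F :- con 1F) :* E)))
             refl a Q (Q ^ suc n) ((ρ * Q) ^ suc n) (R 1# Q n) (R 1# (ρ * Q) n) (poch ρ (a * 1#) (suc n)) (poch ρ (ρ * 1#) n)) ⟩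
      (1# - Q) * R 1# Q n + poch ρ (a * 1#) (suc n) * (Q ^ suc n + (ρ * Q) ^ suc n)
        ≈⟨ +-congˡ (*-congʳ (poch-cong (suc n) refl (*-identityʳ a))) ⟩
      (1# - Q) * R 1# Q n + poch ρ a (suc n) * (Q ^ suc n + (ρ * Q) ^ suc n) ∎
      where open ≈-Reasoning

  -- Gauss's identities for ψ and φ

  triangular : ℕ → ℕ
  triangular zero    = 0
  triangular (suc n) = triangular n ℕ.+ suc n

  ψ-sum : ℕ → Series
  ψ-sum zero    = 0#
  ψ-sum (suc n) = ψ-sum n + X ^ triangular n

  -- This is (-1)ⁿ q^(n²), in the shape in which powers of `Q` produce it.
  φ-term : ℕ → Series
  φ-term n = (- X ^ n) ^ n

  -- The factor 2 of 1 + 2 ∑ (-1)ⁿ qⁿ² is -1 here.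
  φ-sum : ℕ → Series
  φ-sum zero    = 1#
  φ-sum (suc n) = φ-sum n - φ-term (suc n)

  n≤triangular : ∀ n → n ≤ triangular n
  n≤triangular zero    = z≤n
  n≤triangular (suc n) = ℕ.m≤n+m (suc n) (triangular n)

  X^≈[]0 : ∀ {k n} → n ≤ k → X ^ k ≈[ n ] 0#
  X^≈[]0 {k} n≤k = ≈[]-weaken n≤k (≈[]-trans (≈⇒≈[] (sym (*-identityʳ (X ^ k)))) (X^*≈[]0 k 1#))

  ψ φ : Series
  ψ = limit ψ-sum
  φ = limit φ-sum

  ψ-converges : ψ-sum ⟶ ψ
  ψ-converges = limit-converges ψ-sum λ n →
    ≈[]-trans (+-cong-≈[] (≈⇒≈[] refl) (X^≈[]0 (n≤triangular n))) (≈⇒≈[] (+-identityʳ (ψ-sum n)))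

  φ-converges : φ-sum ⟶ φ
  φ-converges = limit-converges φ-sum λ n →
    ≈[]-trans (≈⇒≈[] (solve 3 (λ s x t → s :- (:- x) :* t := s :+ x :* t) refl (φ-sum n) (X ^ suc n) ((- X ^ suc n) ^ n)))
      (≈[]-trans (+-cong-≈[] (≈⇒≈[] refl) (≈[]-weaken (ℕ.n≤1+n n) (X^*≈[]0 (suc n) ((- X ^ suc n) ^ n)))) (≈⇒≈[] (+-identityʳ (φ-sum n))))

  module _ where
    open Shanks (X ^ 2) X

    private
      ρ = X ^ 2

      Q : ℕ → Series
      Q n = X * ρ ^ n

      ρQ : ∀ n → ρ * Q n ≈ Q (suc n)
      ρQ n = solve 3 (λ x ρ r → ρ :* (x :* r) := x :* (ρ :* r)) refl X ρ (ρ ^ n)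

      Q≈X^ : ∀ n → Q n ≈ X ^ suc (2 ℕ.* n)
      Q≈X^ n = *-congˡ (^-assocʳ X 2 n)

      Q^≈X^ : ∀ n k → Q n ^ k ≈ X ^ (suc (2 ℕ.* n) ℕ.* k)
      Q^≈X^ n k = trans (^-congˡ k (Q≈X^ n)) (^-assocʳ X (suc (2 ℕ.* n)) k)

      triangular-odd : ∀ n → triangular (suc (n ℕ.* 2)) ≡ suc (2 ℕ.* n) ℕ.* suc n
      triangular-odd zero    = ≡.refl
      triangular-odd (suc n) = ≡.trans (cong (λ t → t ℕ.+ suc (suc (n ℕ.* 2)) ℕ.+ suc (suc (suc (n ℕ.* 2)))) (triangular-odd n)) (arithmetic n)
        where
        arithmetic : ∀ n → suc (2 ℕ.* n) ℕ.* suc n ℕ.+ suc (suc (n ℕ.* 2)) ℕ.+ suc (suc (suc (n ℕ.* 2))) ≡ suc (2 ℕ.* suc n) ℕ.* suc (suc n)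
        arithmetic = solve-∀

      triangular-even : ∀ n → triangular (suc (suc (n ℕ.* 2))) ≡ suc (2 ℕ.* suc n) ℕ.* suc n
      triangular-even n = ≡.trans (cong (ℕ._+ suc (suc (n ℕ.* 2))) (triangular-odd n)) (arithmetic n)
        where
        arithmetic : ∀ n → suc (2 ℕ.* n) ℕ.* suc n ℕ.+ suc (suc (n ℕ.* 2)) ≡ suc (2 ℕ.* suc n) ℕ.* suc n
        arithmetic = solve-∀

    -- Here ρ = q² and a = q, so `R-step` demands Q = q²ⁿ⁺¹. The terms it adds have exponents
    -- (2n+1)(n+1) and (2n+3)(n+1), the triangular numbers of index 2n+1 and 2n+2; one step thus
    -- adds two terms of ψ.
    ψ-finite : ∀ n → R 1# (X * (X ^ 2) ^ n) n ≈ poch (X ^ 2) X n * ψ-sum (suc (n ℕ.* 2))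
    ψ-finite zero    = solve 0 (con 1F := con 1F :* (con 0F :+ con 1F)) refl
    ψ-finite (suc n) = begin
      R 1# (Q (suc n)) (suc n)     ≈⟨ R-cong 1# (suc n) (ρQ n) ⟨
      R 1# (ρ * Q n) (suc n)       ≈⟨ R-step (Q n) n (solve 2 (λ x r → x :* (x :* r) := x :^ 2 :* r) refl X (ρ ^ n)) ⟩
      (1# - Q n) * R 1# (Q n) n + poch ρ X (suc n) * (Q n ^ suc n + (ρ * Q n) ^ suc n)
        ≈⟨ +-cong (*-congˡ (ψ-finite n)) (*-congˡ (+-cong
             (trans (Q^≈X^ n (suc n)) (^-congʳ X (≡.sym (triangular-odd n))))
             (trans (^-congˡ (suc n) (ρQ n)) (trans (Q^≈X^ (suc n) (suc n)) (^-congʳ X (≡.sym (triangular-even n))))))) ⟩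
      (1# - Q n) * (poch ρ X n * ψ-sum (suc (n ℕ.* 2))) + poch ρ X (suc n) * (T₁ + T₂)
        ≈⟨ solve 6 (λ x r P s t₁ t₂ → (con 1F :- x :* r) :* (P :* s) :+ P :* (con 1F :- r :* x) :* (t₁ :+ t₂) := P :* (con 1F :- r :* x) :* (s :+ t₁ :+ t₂))
             refl X (ρ ^ n) (poch ρ X n) (ψ-sum (suc (n ℕ.* 2))) T₁ T₂ ⟩
      poch ρ X (suc n) * (ψ-sum (suc (n ℕ.* 2)) + T₁ + T₂) ∎
      where
      open ≈-Reasoning
      T₁ = X ^ triangular (suc (n ℕ.* 2))
      T₂ = X ^ triangular (suc (suc (n ℕ.* 2)))

    -- The limit of `ψ-finite`: by `R-head` its left side is (q²; q²)ₙ up to a multiple of q²ⁿ⁺¹.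
    gauss-ψ : limit (poch (X ^ 2) X) * ψ ≈ limit (poch (X ^ 2) (X ^ 2))
    gauss-ψ = ⟶-unique
      (⟶-* (poch-converges (X * 1#) X refl) (⟶-subsequence ψ-converges (λ n → suc (n ℕ.* 2)) (λ n → ℕ.m≤n⇒m≤1+n (ℕ.m≤m*n n 2))))
      (poch-converges (X * 1#) (X ^ 2) refl)
      (λ n → let r , R≈ = R-head 1# (Q n) n in
        ≈[]-trans (≈⇒≈[] (trans (sym (ψ-finite n)) (trans R≈ (+-cong (poch-cong n refl (*-identityʳ ρ)) (*-congʳ (Q≈X^ n))))))
          (≈[]-trans (+-cong-≈[] (≈⇒≈[] refl) (≈[]-weaken (ℕ.m≤n⇒m≤1+n (ℕ.m≤n*m n 2)) (X^*≈[]0 (suc (2 ℕ.* n)) r))) (≈⇒≈[] (+-identityʳ _))))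

  module _ where
    open Shanks X (- 1#)

    private
      Q : ℕ → Series
      Q n = - X ^ suc n

      XQ : ∀ n → X * Q n ≈ Q (suc n)
      XQ n = solve 2 (λ x r → x :* (:- r) := :- (x :* r)) refl X (X ^ suc n)

    -- With ρ = q and a = -1, the demand is Q = -qⁿ⁺¹. The two added terms are Qⁿ⁺¹ and qⁿ⁺¹Qⁿ⁺¹;
    -- their factor 1 + qⁿ⁺¹ completes the product, and 1 - a = 2 becomes the sign -1.
    φ-finite : ∀ n → R 1# (- X ^ suc n) n ≈ poch X (- X) n * φ-sum n
    φ-finite zero    = sym (*-identityʳ 1#)
    φ-finite (suc n) = begin
      R 1# (Q (suc n)) (suc n)     ≈⟨ R-cong 1# (suc n) (XQ n) ⟨
      R 1# (X * Q n) (suc n)       ≈⟨ R-step (Q n) n (solve 1 (λ r → (:- con 1F) :* (:- r) := r) refl (X ^ suc n)) ⟩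
      (1# - Q n) * R 1# (Q n) n + poch X (- 1#) (suc n) * (Q n ^ suc n + (X * Q n) ^ suc n)
        ≈⟨ +-cong (*-congˡ (φ-finite n)) (*-cong
             (trans (poch-suc X (- 1#) n) (*-congˡ (poch-cong n refl (solve 1 (λ x → x :* (:- con 1F) := :- x) refl X))))
             (+-congˡ (^-distrib-* X (Q n) (suc n)))) ⟩
      (1# - Q n) * (poch X (- X) n * φ-sum n) + (1# - - 1#) * poch X (- X) n * (Q n ^ suc n + X ^ suc n * Q n ^ suc n)
        ≈⟨ solve 5 (λ x r P s t → (con 1F :- (:- (x :* r))) :* (P :* s) :+ (con 1F :- (:- con 1F)) :* P :* (t :+ x :* r :* t)
             := P :* (con 1F :- r :* (:- x)) :* (s :- t)) refl X (X ^ n) (poch X (- X) n) (φ-sum n) (Q n ^ suc n) ⟩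
      poch X (- X) (suc n) * (φ-sum n - Q n ^ suc n) ∎
      where open ≈-Reasoning

    gauss-φ : limit (poch X (- X)) * φ ≈ limit (poch X X)
    gauss-φ = ⟶-unique
      (⟶-* (poch-converges 1# (- X) (sym (*-identityʳ X))) φ-converges)
      (poch-converges 1# X (sym (*-identityʳ X)))
      (λ n → let r , R≈ = R-head 1# (Q n) n in
        ≈[]-trans (≈⇒≈[] (trans (sym (φ-finite n)) (trans R≈ (+-cong (poch-cong n refl (*-identityʳ X)) (solve 2 (λ q r → (:- q) :* r := q :* (:- r)) refl (X ^ suc n) r)))))
          (≈[]-trans (+-cong-≈[] (≈⇒≈[] refl) (≈[]-weaken (ℕ.n≤1+n n) (X^*≈[]0 (suc n) (- r)))) (≈⇒≈[] (+-identityʳ _))))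

  -- Product formulas linking f₁, f₂ and f₄

  f₁ : Series
  f₁ = limit (poch X X)

  f₁-converges : poch X X ⟶ f₁
  f₁-converges = poch-converges 1# X (sym (*-identityʳ X))

  private
    X≈X*1 : X ≈ X * 1#
    X≈X*1 = sym (*-identityʳ X)

  expand₂-f₁ : expand₂ f₁ ≈ limit (poch (X ^ 2) (X ^ 2))
  expand₂-f₁ = ⟶-unique (⟶-expand₂ f₁-converges) (poch-converges (X * 1#) (X ^ 2) refl)
    (λ n → ≈⇒≈[] (trans (expand₂-poch X X n) (poch-cong n expand₂-X expand₂-X)))

  f₁≈odd*f₂ : f₁ ≈ limit (poch (X ^ 2) X) * expand₂ f₁
  f₁≈odd*f₂ = trans (⟶-unique (⟶-subsequence f₁-converges (ℕ._* 2) (λ n → ℕ.m≤m*n n 2))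
    (⟶-* (poch-converges (X * 1#) X refl) (poch-converges (X * 1#) (X ^ 2) refl))
    (λ n → ≈⇒≈[] (trans (poch-even-odd X X n) (*-congˡ (poch-cong n refl (*-congˡ X≈X*1))))))
    (*-congˡ (sym expand₂-f₁))

  f₁*distinct≈f₂ : f₁ * limit (poch X (- X)) ≈ expand₂ f₁
  f₁*distinct≈f₂ = trans (⟶-unique (⟶-* f₁-converges (poch-converges 1# (- X) X≈X*1)) (poch-converges (X * 1#) (X ^ 2) refl)
    (λ n → ≈⇒≈[] (poch-squares X X n))) (sym expand₂-f₁)

  ψf₁≈f₂² : ψ * f₁ ≈ expand₂ f₁ ^ 2
  ψf₁≈f₂² = begin
    ψ * f₁                        ≈⟨ *-congˡ f₁≈odd*f₂ ⟩
    ψ * (H * expand₂ f₁)          ≈⟨ solve 3 (λ p h y → p :* (h :* y) := h :* p :* (y :* con 1F)) refl ψ H (expand₂ f₁) ⟩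
    H * ψ * (expand₂ f₁ * 1#)     ≈⟨ *-congʳ (trans gauss-ψ (sym expand₂-f₁)) ⟩
    expand₂ f₁ ^ 2                ∎
    where
    open ≈-Reasoning
    H = limit (poch (X ^ 2) X)

  φf₂≈f₁² : φ * expand₂ f₁ ≈ f₁ ^ 2
  φf₂≈f₁² = begin
    φ * expand₂ f₁     ≈⟨ *-congˡ f₁*distinct≈f₂ ⟨
    φ * (f₁ * N)       ≈⟨ solve 3 (λ p n x → p :* (x :* n) := n :* p :* (x :* con 1F)) refl φ N f₁ ⟩
    N * φ * (f₁ * 1#)  ≈⟨ *-congʳ gauss-φ ⟩
    f₁ ^ 2             ∎
    where
    open ≈-Reasoning
    N = limit (poch X (- X))

  -- The product of all 1 + q²ⁿ⁺¹.
  oddDistinct : Series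
  oddDistinct = limit (poch (X ^ 2) (- X))

  -- Let H be the product of all 1 - q²ⁿ⁺¹, so f₁ = H f₂. Pairing factors, H times `oddDistinct` is
  -- H at q², and H(q²) f₄ = f₂ is the image of the first equation under q ↦ q².
  oddDistinct-f₁f₄ : oddDistinct * (f₁ * expand₂ (expand₂ f₁)) ≈ expand₂ f₁ ^ 2
  oddDistinct-f₁f₄ = begin
    oddDistinct * (f₁ * z)         ≈⟨ *-congˡ (*-congʳ f₁≈odd*f₂) ⟩
    oddDistinct * (H * y * z)      ≈⟨ solve 4 (λ o h y z → o :* (h :* y :* z) := h :* o :* z :* (y :* con 1F)) refl oddDistinct H y z ⟩
    H * oddDistinct * z * (y * 1#) ≈⟨ *-congʳ (*-congʳ (⟶-unique
        (⟶-* (poch-converges (X * 1#) X refl) (poch-converges (X * 1#) (- X) refl)) (⟶-expand₂ (poch-converges (X * 1#) X refl))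
        (λ n → ≈⇒≈[] (trans (poch-squares (X ^ 2) X n) (trans (poch-cong n (sym (trans (expand₂-^ X 2) (^-congˡ 2 expand₂-X))) (sym expand₂-X)) (sym (expand₂-poch (X ^ 2) X n))))))) ⟩
    expand₂ H * z * (y * 1#)       ≈⟨ *-congʳ (trans (sym (expand₂-* H y)) (expand₂-cong (sym f₁≈odd*f₂))) ⟩
    y ^ 2                          ∎
    where
    open ≈-Reasoning
    H = limit (poch (X ^ 2) X)
    y = expand₂ f₁
    z = expand₂ y

  -- Sections of ψ and φ from their exponents

  U-X : ∀ j → U (suc j) X ≈ U j 1#
  U-X j = trans (U-cong (suc j) X≈X*1) (U-suc-X j 1#)

  U₀X≈0 : U 0 X ≈ 0#
  U₀X≈0 = trans (U-cong 0 X≈X*1) (trans (U₀-X 1#) (trans (*-congˡ U₂-1) (zeroʳ X)))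

  U-cube*X : ∀ j → j < 3 → ∀ {f} a → f ≈ a ^ 3 * X → U j f ≈ a * U j X
  U-cube*X j j<3 a f≈ = trans (U-cong j f≈) (U-cube j j<3 a X)

  U-is-cube : ∀ j → j < 3 → ∀ {f} a → f ≈ a ^ 3 → U j f ≈ a * U j 1#
  U-is-cube j j<3 a f≈ = trans (U-cong j f≈) (U-cube-1 j j<3 a)

  X^-cube : ∀ k → X ^ (k ℕ.* 3) ≈ (X ^ k) ^ 3
  X^-cube k = sym (^-assocʳ X k 3)

  -- This is 9T + 1 with T the triangular number of `n`, while the indices 3n+2 and 3n+3 give
  -- multiples of 3. So no exponent of ψ is 2 modulo 3, and class 1 forms qψ(q⁹) = qψ⁹.
  triangular-3n+1 : ∀ n → triangular (1 ℕ.+ n ℕ.* 3) ≡ 1 ℕ.+ triangular n ℕ.* 3 ℕ.* 3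
  triangular-3n+1 zero    = ≡.refl
  triangular-3n+1 (suc n) = ≡.trans
    (cong (λ t → t ℕ.+ (2 ℕ.+ n ℕ.* 3) ℕ.+ (3 ℕ.+ n ℕ.* 3) ℕ.+ (4 ℕ.+ n ℕ.* 3)) (triangular-3n+1 n))
    (arithmetic (triangular n) n)
    where
    arithmetic : ∀ t n → 1 ℕ.+ t ℕ.* 3 ℕ.* 3 ℕ.+ (2 ℕ.+ n ℕ.* 3) ℕ.+ (3 ℕ.+ n ℕ.* 3) ℕ.+ (4 ℕ.+ n ℕ.* 3) ≡ 1 ℕ.+ (t ℕ.+ suc n) ℕ.* 3 ℕ.* 3
    arithmetic = solve-∀

  triangular-3n+2 : ∀ n → triangular (2 ℕ.+ n ℕ.* 3) ≡ (triangular n ℕ.* 3 ℕ.+ n ℕ.+ 1) ℕ.* 3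
  triangular-3n+2 n = ≡.trans (cong (ℕ._+ (2 ℕ.+ n ℕ.* 3)) (triangular-3n+1 n)) (arithmetic (triangular n) n)
    where
    arithmetic : ∀ t n → 1 ℕ.+ t ℕ.* 3 ℕ.* 3 ℕ.+ (2 ℕ.+ n ℕ.* 3) ≡ (t ℕ.* 3 ℕ.+ n ℕ.+ 1) ℕ.* 3
    arithmetic = solve-∀

  triangular-3n+3 : ∀ n → triangular (3 ℕ.+ n ℕ.* 3) ≡ (triangular n ℕ.* 3 ℕ.+ n ℕ.+ 1 ℕ.+ suc n) ℕ.* 3
  triangular-3n+3 n = ≡.trans (cong (ℕ._+ (3 ℕ.+ n ℕ.* 3)) (triangular-3n+2 n)) (arithmetic (triangular n) n)
    where
    arithmetic : ∀ t n → (t ℕ.* 3 ℕ.+ n ℕ.+ 1) ℕ.* 3 ℕ.+ (3 ℕ.+ n ℕ.* 3) ≡ (t ℕ.* 3 ℕ.+ n ℕ.+ 1 ℕ.+ suc n) ℕ.* 3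
    arithmetic = solve-∀

  U-+₄ : ∀ j f g h k → U j (f + g + h + k) ≈ U j f + U j g + U j h + U j k
  U-+₄ j f g h k = trans (U-+ j (f + g + h) k) (+-congʳ (trans (U-+ j (f + g) h) (+-congʳ (U-+ j f g))))

  -- Serves j = 1 and j = 2 together: `U j 1# ≈ 0#` removes the exponents divisible by 3, and
  -- `U j X` is 1 or 0 according to `j`.
  U-ψ-sum : ∀ j → j < 3 → U j 1# ≈ 0# → ∀ n → U j (ψ-sum (1 ℕ.+ n ℕ.* 3)) ≈ ψ-sum n ^ 3 * U j X
  U-ψ-sum j j<3 U1≈0 zero    = begin
    U j (0# + 1#)     ≈⟨ U-cong j (+-identityˡ 1#) ⟩
    U j 1#            ≈⟨ U1≈0 ⟩
    0#                ≈⟨ solve 1 (λ u → con 0F := con 0F :^ 3 :* u) refl (U j X) ⟩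
    0# ^ 3 * U j X    ∎
    where open ≈-Reasoning
  U-ψ-sum j j<3 U1≈0 (suc n) = begin
    U j (ψ-sum (1 ℕ.+ n ℕ.* 3) + X ^ triangular (1 ℕ.+ n ℕ.* 3) + X ^ triangular (2 ℕ.+ n ℕ.* 3) + X ^ triangular (3 ℕ.+ n ℕ.* 3))
      ≈⟨ U-+₄ j (ψ-sum (1 ℕ.+ n ℕ.* 3)) (X ^ triangular (1 ℕ.+ n ℕ.* 3)) (X ^ triangular (2 ℕ.+ n ℕ.* 3)) (X ^ triangular (3 ℕ.+ n ℕ.* 3)) ⟩
    U j (ψ-sum (1 ℕ.+ n ℕ.* 3)) + U j (X ^ triangular (1 ℕ.+ n ℕ.* 3)) + U j (X ^ triangular (2 ℕ.+ n ℕ.* 3)) + U j (X ^ triangular (3 ℕ.+ n ℕ.* 3))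
      ≈⟨ +-cong (+-cong (+-cong (U-ψ-sum j j<3 U1≈0 n)
           (U-cube*X j j<3 (X ^ (t ℕ.* 3)) (trans (^-congʳ X (triangular-3n+1 n)) (trans (*-comm X (X ^ (t ℕ.* 3 ℕ.* 3))) (*-congʳ (X^-cube (t ℕ.* 3)))))))
           (U-is-cube j j<3 (X ^ a) (trans (^-congʳ X (triangular-3n+2 n)) (X^-cube a))))
           (U-is-cube j j<3 (X ^ c) (trans (^-congʳ X (triangular-3n+3 n)) (X^-cube c))) ⟩
    ψ-sum n ^ 3 * U j X + X ^ (t ℕ.* 3) * U j X + X ^ a * U j 1# + X ^ c * U j 1#
      ≈⟨ +-cong (+-cong (+-congˡ (*-congʳ (X^-cube t))) (*-congˡ U1≈0)) (*-congˡ U1≈0) ⟩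
    ψ-sum n ^ 3 * U j X + (X ^ t) ^ 3 * U j X + X ^ a * 0# + X ^ c * 0#
      ≈⟨ solve 5 (λ s x u a b → s :^ 3 :* u :+ x :^ 3 :* u :+ a :* con 0F :+ b :* con 0F := (s :+ x) :^ 3 :* u) refl (ψ-sum n) (X ^ t) (U j X) (X ^ a) (X ^ c) ⟩
    (ψ-sum n + X ^ t) ^ 3 * U j X ∎
    where
    open ≈-Reasoning
    t = triangular n
    a = t ℕ.* 3 ℕ.+ n ℕ.+ 1
    c = t ℕ.* 3 ℕ.+ n ℕ.+ 1 ℕ.+ suc n

  U-ψ : ∀ j → j < 3 → U j 1# ≈ 0# → U j ψ ≈ ψ ^ 3 * U j X
  U-ψ j j<3 U1≈0 = ⟶-unique
    (⟶-U j (⟶-subsequence ψ-converges (λ n → 1 ℕ.+ n ℕ.* 3) (λ n → ℕ.m≤n⇒m≤1+n (ℕ.m≤m*n n 3))))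
    (⟶-* (⟶-^ ψ-converges 3) (converges λ N → 0 , λ _ _ → ≈⇒≈[] refl))
    (λ n → ≈⇒≈[] (U-ψ-sum j j<3 U1≈0 n))

  U₁ψ≈ψ³ : U 1 ψ ≈ ψ ^ 3
  U₁ψ≈ψ³ = trans (U-ψ 1 1<3 U₁-1) (trans (*-congˡ (trans (U-X 0) U₀-1)) (*-identityʳ (ψ ^ 3)))

  U₂ψ≈0 : U 2 ψ ≈ 0#
  U₂ψ≈0 = trans (U-ψ 2 2<3 U₂-1) (trans (*-congˡ (trans (U-X 1) U₁-1)) (zeroʳ (ψ ^ 3)))

  neg-cube : ∀ f → - f ^ 3 ≈ (- f) ^ 3
  neg-cube = solve 1 (λ f → :- f :^ 3 := (:- f) :^ 3) refl

  φ-term-3n : ∀ n → φ-term (n ℕ.* 3) ≈ (φ-term n ^ 3) ^ 3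
  φ-term-3n n = begin
    (- X ^ (n ℕ.* 3)) ^ (n ℕ.* 3)   ≈⟨ ^-congˡ (n ℕ.* 3) (trans (-‿cong (X^-cube n)) (neg-cube (X ^ n))) ⟩
    ((- X ^ n) ^ 3) ^ (n ℕ.* 3)     ≈⟨ ^-assocʳ ((- X ^ n) ^ 3) n 3 ⟨
    (((- X ^ n) ^ 3) ^ n) ^ 3       ≈⟨ ^-congˡ 3 (^-swap (- X ^ n) 3 n) ⟩
    (φ-term n ^ 3) ^ 3              ∎
    where open ≈-Reasoning

  φ-term-3n+1 : ∀ n → φ-term (1 ℕ.+ n ℕ.* 3) ≈ (- (X ^ n * (- X ^ (1 ℕ.+ n ℕ.* 3)) ^ n)) ^ 3 * X
  φ-term-3n+1 n = begin
    - (X * X ^ (n ℕ.* 3)) * s ^ (n ℕ.* 3)     ≈⟨ *-cong (-‿cong (*-congˡ (X^-cube n))) (sym (^-assocʳ s n 3)) ⟩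
    - (X * (X ^ n) ^ 3) * (s ^ n) ^ 3         ≈⟨ solve 3 (λ x a b → (:- (x :* a :^ 3)) :* b :^ 3 := (:- (a :* b)) :^ 3 :* x) refl X (X ^ n) (s ^ n) ⟩
    (- (X ^ n * s ^ n)) ^ 3 * X               ∎
    where
    open ≈-Reasoning
    s = - X ^ (1 ℕ.+ n ℕ.* 3)

  φ-term-3n+2 : ∀ n → φ-term (2 ℕ.+ n ℕ.* 3) ≈ (X * X ^ n * X ^ n * (- X ^ (2 ℕ.+ n ℕ.* 3)) ^ n) ^ 3 * X
  φ-term-3n+2 n = begin
    - (X * (X * X ^ (n ℕ.* 3))) * (- (X * (X * X ^ (n ℕ.* 3))) * s ^ (n ℕ.* 3))
      ≈⟨ *-cong (-‿cong (*-congˡ (*-congˡ (X^-cube n)))) (*-cong (-‿cong (*-congˡ (*-congˡ (X^-cube n)))) (sym (^-assocʳ s n 3))) ⟩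
    - (X * (X * (X ^ n) ^ 3)) * (- (X * (X * (X ^ n) ^ 3)) * (s ^ n) ^ 3)
      ≈⟨ solve 3 (λ x a b → (:- (x :* (x :* a :^ 3))) :* ((:- (x :* (x :* a :^ 3))) :* b :^ 3) := (x :* a :* a :* b) :^ 3 :* x) refl X (X ^ n) (s ^ n) ⟩
    (X * X ^ n * X ^ n * s ^ n) ^ 3 * X ∎
    where
    open ≈-Reasoning
    s = - X ^ (2 ℕ.+ n ℕ.* 3)

  -- Squares are 0 or 1 modulo 3, and class 0 comes from the indices 3n alone, with exponents 9n².
  -- Serves j = 0 and j = 2, where `U j X ≈ 0#` removes class 1.
  U-φ-sum : ∀ j → j < 3 → U j X ≈ 0# → ∀ n → U j (φ-sum (n ℕ.* 3)) ≈ φ-sum n ^ 3 * U j 1#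
  U-φ-sum j j<3 UX≈0 zero    = solve 1 (λ u → u := con 1F :^ 3 :* u) refl (U j 1#)
  U-φ-sum j j<3 UX≈0 (suc n) = begin
    U j (φ-sum (n ℕ.* 3) - φ-term (1 ℕ.+ n ℕ.* 3) - φ-term (2 ℕ.+ n ℕ.* 3) - φ-term (3 ℕ.+ n ℕ.* 3))
      ≈⟨ U-+₄ j (φ-sum (n ℕ.* 3)) (- φ-term (1 ℕ.+ n ℕ.* 3)) (- φ-term (2 ℕ.+ n ℕ.* 3)) (- φ-term (3 ℕ.+ n ℕ.* 3)) ⟩
    U j (φ-sum (n ℕ.* 3)) + U j (- φ-term (1 ℕ.+ n ℕ.* 3)) + U j (- φ-term (2 ℕ.+ n ℕ.* 3)) + U j (- φ-term (3 ℕ.+ n ℕ.* 3))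
      ≈⟨ +-cong (+-cong (+-cong (U-φ-sum j j<3 UX≈0 n)
           (trans (U-neg j (φ-term (1 ℕ.+ n ℕ.* 3))) (-‿cong (trans (U-cube*X j j<3 a (φ-term-3n+1 n)) (*-congˡ UX≈0)))))
           (trans (U-neg j (φ-term (2 ℕ.+ n ℕ.* 3))) (-‿cong (trans (U-cube*X j j<3 c (φ-term-3n+2 n)) (*-congˡ UX≈0)))))
           (trans (U-neg j (φ-term (3 ℕ.+ n ℕ.* 3))) (-‿cong (U-is-cube j j<3 (φ-term (suc n) ^ 3) (φ-term-3n (suc n))))) ⟩
    φ-sum n ^ 3 * U j 1# + - (a * 0#) + - (c * 0#) + - (φ-term (suc n) ^ 3 * U j 1#)
      ≈⟨ solve 5 (λ s t u a b → s :^ 3 :* u :+ :- (a :* con 0F) :+ :- (b :* con 0F) :+ :- (t :^ 3 :* u) := (s :- t) :^ 3 :* u) refl (φ-sum n) (φ-term (suc n)) (U j 1#) a c ⟩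
    (φ-sum n - φ-term (suc n)) ^ 3 * U j 1# ∎
    where
    open ≈-Reasoning
    a = - (X ^ n * (- X ^ (1 ℕ.+ n ℕ.* 3)) ^ n)
    c = X * X ^ n * X ^ n * (- X ^ (2 ℕ.+ n ℕ.* 3)) ^ n

  U-φ : ∀ j → j < 3 → U j X ≈ 0# → U j φ ≈ φ ^ 3 * U j 1#
  U-φ j j<3 UX≈0 = ⟶-unique
    (⟶-U j (⟶-subsequence φ-converges (ℕ._* 3) (λ n → ℕ.m≤m*n n 3)))
    (⟶-* (⟶-^ φ-converges 3) (converges λ N → 0 , λ _ _ → ≈⇒≈[] refl))
    (λ n → ≈⇒≈[] (U-φ-sum j j<3 UX≈0 n))

  U₀φ≈φ³ : U 0 φ ≈ φ ^ 3
  U₀φ≈φ³ = trans (U-φ 0 0<3 U₀X≈0) (trans (*-congˡ U₀-1) (*-identityʳ (φ ^ 3)))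

  U₂φ≈0 : U 2 φ ≈ 0#
  U₂φ≈0 = trans (U-φ 2 2<3 (trans (U-X 1) U₁-1)) (trans (*-congˡ U₂-1) (zeroʳ (φ ^ 3)))

-- Relations between x, y, z and the sections they determine

module Dissection where

  open PowerSeries

  module Theta
    (x ψ φ : Series) (x₀ : x 0 ≡ 1F) (ψ₀ : ψ 0 ≡ 1F) (φ₀ : φ 0 ≡ 1F)
    (ψx≈y² : ψ * x ≈ expand₂ x ^ 2) (φy≈x² : φ * expand₂ x ≈ x ^ 2)
    (U₁ψ : U 1 ψ ≈ ψ ^ 3) (U₂ψ : U 2 ψ ≈ 0#) (U₀φ : U 0 φ ≈ φ ^ 3) (U₂φ : U 2 φ ≈ 0#)
    where

    y z α β ψ₂ α₂ : Series
    y = expand₂ x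
    z = expand₂ y
    α = U 0 ψ
    β = U 1 φ
    ψ₂ = expand₂ ψ
    α₂ = expand₂ α

    ψ-sections : ψ ≈ α ^ 3 + X * (ψ ^ 3) ^ 3
    ψ-sections = begin
      ψ ≈⟨ sections ψ ⟩
      α ^ 3 + X * U 1 ψ ^ 3 + X * (X * U 2 ψ ^ 3) ≈⟨ +-cong (+-congˡ (*-congˡ (^-congˡ 3 U₁ψ))) (*-congˡ (*-congˡ (^-congˡ 3 U₂ψ))) ⟩
      α ^ 3 + X * (ψ ^ 3) ^ 3 + X * (X * 0# ^ 3)  ≈⟨ solve 3 (λ a b x → a :+ b :+ x :* (x :* con 0F :^ 3) := a :+ b) refl (α ^ 3) (X * (ψ ^ 3) ^ 3) X ⟩
      α ^ 3 + X * (ψ ^ 3) ^ 3                     ∎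
      where open ≈-Reasoning

    φ-sections : φ ≈ (φ ^ 3) ^ 3 + X * β ^ 3
    φ-sections = begin
      φ ≈⟨ sections φ ⟩
      U 0 φ ^ 3 + X * β ^ 3 + X * (X * U 2 φ ^ 3) ≈⟨ +-cong (+-congʳ (^-congˡ 3 U₀φ)) (*-congˡ (*-congˡ (^-congˡ 3 U₂φ))) ⟩
      (φ ^ 3) ^ 3 + X * β ^ 3 + X * (X * 0# ^ 3)  ≈⟨ solve 3 (λ a b x → a :+ b :+ x :* (x :* con 0F :^ 3) := a :+ b) refl ((φ ^ 3) ^ 3) (X * β ^ 3) X ⟩
      (φ ^ 3) ^ 3 + X * β ^ 3                     ∎
      where open ≈-Reasoning

    φ²ψ≈x³ : φ ^ 2 * ψ ≈ x ^ 3
    φ²ψ≈x³ = *-cancelˡ (x * y ^ 2) (1-* {x} {y ^ 2} x₀ (1-^ {y} 2 x₀)) (begin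
      x * y ^ 2 * (φ ^ 2 * ψ)   ≈⟨ solve 4 (λ x y f p → x :* y :^ 2 :* (f :^ 2 :* p) := (f :* y) :^ 2 :* (p :* x)) refl x y φ ψ ⟩
      (φ * y) ^ 2 * (ψ * x)     ≈⟨ *-cong (^-congˡ 2 φy≈x²) ψx≈y² ⟩
      (x ^ 2) ^ 2 * y ^ 2       ≈⟨ solve 2 (λ x y → (x :^ 2) :^ 2 :* y :^ 2 := x :* y :^ 2 :* x :^ 3) refl x y ⟩
      x * y ^ 2 * x ^ 3         ∎)
      where open ≈-Reasoning

    -- Since 2 = -1, the vanishing class-1 part of φ²ψ is φ³ times the difference of the two sides,
    -- up to sign.
    αβ≈φ³ψ³ : α * β ≈ φ ^ 3 * ψ ^ 3
    αβ≈φ³ψ³ = *-cancelˡ (φ ^ 3) (1-^ {φ} 3 φ₀) (linear₁ 1# vanish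
      (solve 4 (λ f p a b → f :* (a :* b) :- f :* (f :* p) := con 1F :* (con 0F :- (con 2F :* f :* b :* a :+ f :^ 2 :* p))) refl (φ ^ 3) (ψ ^ 3) α β))
      where
      open ≈-Reasoning
      -- `c₀`, `c₁` and `c₂` are the cube roots of the three parts of `φ ^ 2 * ψ`, found by
      -- expanding the product of the dissections; the term of `c₀` with `X` is a carry from q³.
      c₁ = constant 2F * φ ^ 3 * β * α + (φ ^ 3) ^ 2 * ψ ^ 3
      c₀ = (φ ^ 3) ^ 2 * α + X * β ^ 2 * ψ ^ 3
      c₂ = β ^ 2 * α + constant 2F * φ ^ 3 * β * ψ ^ 3
      vanish : 0# ≈ c₁
      vanish = begin
        0#                ≈⟨ zeroʳ x ⟨
        x * 0#            ≈⟨ *-congˡ U₁-1 ⟨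
        x * U 1 1#        ≈⟨ U-cube-1 1 1<3 x ⟨
        U 1 (x ^ 3)       ≈⟨ U-cong 1 φ²ψ≈x³ ⟨
        U 1 (φ ^ 2 * ψ)   ≈⟨ U-cong 1 (*-cong (^-congˡ 2 φ-sections) ψ-sections) ⟩
        U 1 (((φ ^ 3) ^ 3 + X * β ^ 3) ^ 2 * (α ^ 3 + X * (ψ ^ 3) ^ 3))
          ≈⟨ U-cong 1 (solve 5 (λ q f p a b → (f :^ 3 :+ q :* b :^ 3) :^ 2 :* (a :^ 3 :+ q :* p :^ 3)
               := (f :^ 2 :* a :+ q :* b :^ 2 :* p) :^ 3 :+ q :* (con 2F :* f :* b :* a :+ f :^ 2 :* p) :^ 3
                  :+ q :* (q :* (b :^ 2 :* a :+ con 2F :* f :* b :* p) :^ 3)) refl X (φ ^ 3) (ψ ^ 3) α β) ⟩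
        U 1 (c₀ ^ 3 + X * c₁ ^ 3 + X * (X * c₂ ^ 3)) ≈⟨ U₁-sections c₀ c₁ c₂ ⟩
        c₁ ∎

    1≈Xψ⁸+φ⁸ : 1# ≈ X * ψ ^ 8 + φ ^ 8
    1≈Xψ⁸+φ⁸ = *-cancelˡ (φ * ψ) (1-* {φ} {ψ} φ₀ ψ₀) (linear₁ 1# product
      (solve 3 (λ q f p → f :* p :* con 1F :- f :* p :* (q :* p :^ 8 :+ f :^ 8)
         := con 1F :* ((p :- q :* (p :^ 3) :^ 3) :* (f :- (f :^ 3) :^ 3) :- q :* (f :^ 3 :* p :^ 3) :^ 3)) refl X φ ψ))
      where
      open ≈-Reasoning
      product : (ψ - X * (ψ ^ 3) ^ 3) * (φ - (φ ^ 3) ^ 3) ≈ X * (φ ^ 3 * ψ ^ 3) ^ 3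
      product = begin
        (ψ - X * (ψ ^ 3) ^ 3) * (φ - (φ ^ 3) ^ 3)
          ≈⟨ *-cong (+-congʳ ψ-sections) (+-congʳ φ-sections) ⟩
        (α ^ 3 + X * (ψ ^ 3) ^ 3 - X * (ψ ^ 3) ^ 3) * ((φ ^ 3) ^ 3 + X * β ^ 3 - (φ ^ 3) ^ 3)
          ≈⟨ solve 5 (λ q a p f b → (a :^ 3 :+ p :- p) :* (f :+ q :* b :^ 3 :- f) := q :* (a :* b) :^ 3) refl X α (X * (ψ ^ 3) ^ 3) ((φ ^ 3) ^ 3) β ⟩
        X * (α * β) ^ 3 ≈⟨ *-congˡ (^-congˡ 3 αβ≈φ³ψ³) ⟩
        X * (φ ^ 3 * ψ ^ 3) ^ 3 ∎

    x⁸y⁸≈x²⁴+Xy²⁴ : x ^ 8 * y ^ 8 ≈ (x ^ 8) ^ 3 + X * (y ^ 8) ^ 3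
    x⁸y⁸≈x²⁴+Xy²⁴ = begin
      x ^ 8 * y ^ 8                                 ≈⟨ *-identityʳ (x ^ 8 * y ^ 8) ⟨
      x ^ 8 * y ^ 8 * 1#                            ≈⟨ *-congˡ 1≈Xψ⁸+φ⁸ ⟩
      x ^ 8 * y ^ 8 * (X * ψ ^ 8 + φ ^ 8)
        ≈⟨ solve 5 (λ q a b p f → a :* b :* (q :* p :+ f) := q :* (p :* a) :* b :+ (f :* b) :* a) refl X (x ^ 8) (y ^ 8) (ψ ^ 8) (φ ^ 8) ⟩
      X * (ψ ^ 8 * x ^ 8) * y ^ 8 + φ ^ 8 * y ^ 8 * x ^ 8
        ≈⟨ +-cong (*-congʳ (*-congˡ (trans (sym (^-distrib-* ψ x 8)) (^-congˡ 8 ψx≈y²)))) (*-congʳ (trans (sym (^-distrib-* φ y 8)) (^-congˡ 8 φy≈x²))) ⟩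
      X * (y ^ 2) ^ 8 * y ^ 8 + (x ^ 2) ^ 8 * x ^ 8
        ≈⟨ solve 3 (λ q x y → q :* (y :^ 2) :^ 8 :* y :^ 8 :+ (x :^ 2) :^ 8 :* x :^ 8 := (x :^ 8) :^ 3 :+ q :* (y :^ 8) :^ 3) refl X x y ⟩
      (x ^ 8) ^ 3 + X * (y ^ 8) ^ 3 ∎
      where open ≈-Reasoning

    y⁸z⁸≈y²⁴+X²z²⁴ : y ^ 8 * z ^ 8 ≈ (y ^ 8) ^ 3 + X ^ 2 * (z ^ 8) ^ 3
    y⁸z⁸≈y²⁴+X²z²⁴ = begin
      y ^ 8 * z ^ 8                       ≈⟨ trans (expand₂-* (x ^ 8) (y ^ 8)) (*-cong (expand₂-^ x 8) (expand₂-^ y 8)) ⟨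
      expand₂ (x ^ 8 * y ^ 8)             ≈⟨ expand₂-cong x⁸y⁸≈x²⁴+Xy²⁴ ⟩
      expand₂ ((x ^ 8) ^ 3 + X * (y ^ 8) ^ 3)
        ≈⟨ trans (expand₂-+ ((x ^ 8) ^ 3) (X * (y ^ 8) ^ 3)) (+-cong (expand₂-^ (x ^ 8) 3) (trans (expand₂-* X ((y ^ 8) ^ 3)) (*-cong expand₂-X (expand₂-^ (y ^ 8) 3)))) ⟩
      expand₂ (x ^ 8) ^ 3 + X ^ 2 * expand₂ (y ^ 8) ^ 3
        ≈⟨ +-cong (^-congˡ 3 (expand₂-^ x 8)) (*-congˡ (^-congˡ 3 (expand₂-^ y 8))) ⟩
      (y ^ 8) ^ 3 + X ^ 2 * (z ^ 8) ^ 3   ∎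
      where open ≈-Reasoning

    x⁸≈y⁴+Xz⁸ : x ^ 8 ≈ y ^ 4 + X * z ^ 8
    x⁸≈y⁴+Xz⁸ = linear₁ 1# w≈y⁴
      (solve 4 (λ q x y z → x :^ 8 :- (y :^ 4 :+ q :* z :^ 8) := con 1F :* (x :^ 8 :- q :* z :^ 8 :- y :^ 4)) refl X x y z)
      where
      w : Series
      w = x ^ 8 - X * z ^ 8
      w₀ : w 0 ≡ 1F
      w₀ = 1-X* {x ^ 8} {z ^ 8} (1-^ {x} 8 x₀)
      w³≈y⁸w : w * w ^ 2 ≈ w * y ^ 8
      -- As w³ = x²⁴ - q³z²⁴, subtracting q times the second relation from the first cancels y²⁴ and
      -- leaves wy⁸ = w³.
      w³≈y⁸w = linear₂ (- 1#) X x⁸y⁸≈x²⁴+Xy²⁴ y⁸z⁸≈y²⁴+X²z²⁴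
        (solve 4 (λ q a b c → (a :- q :* c) :* (a :- q :* c) :^ 2 :- (a :- q :* c) :* b
          := (:- con 1F) :* (a :* b :- (a :^ 3 :+ q :* b :^ 3)) :+ q :* (b :* c :- (b :^ 3 :+ q :^ 2 :* c :^ 3))) refl X (x ^ 8) (y ^ 8) (z ^ 8))
      w≈y⁴ : w ≈ y ^ 4
      -- From w² = y⁸ the factor w + y⁴ has to be cancelled. Its constant term is 2, and the sign
      -- turns this into 1.
      w≈y⁴ = *-cancelˡ (- (w + y ^ 4)) (1-neg-+ {w} {y ^ 4} w₀ (1-^ {y} 4 x₀))
        (linear₁ (- 1#) (*-cancelˡ w {w ^ 2} {y ^ 8} w₀ w³≈y⁸w)
          (solve 2 (λ w y → (:- (w :+ y :^ 4)) :* w :- (:- (w :+ y :^ 4)) :* y :^ 4 := (:- con 1F) :* (w :^ 2 :- y :^ 8)) refl w y))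

    -- Substituting y⁴ = x⁸ - qz⁸ into qy²⁴ = x⁸(y⁸ - x¹⁶) makes the right side divisible by q.
    y²⁴≈x¹⁶z⁸+Xx⁸z¹⁶ : (y ^ 8) ^ 3 ≈ x ^ 16 * z ^ 8 + X * (x ^ 8 * z ^ 16)
    y²⁴≈x¹⁶z⁸+Xx⁸z¹⁶ = X*-cancel (linear₂ (- 1#) (- (x ^ 8 * (y ^ 4 + x ^ 8 - X * z ^ 8))) x⁸y⁸≈x²⁴+Xy²⁴ x⁸≈y⁴+Xz⁸
      (solve 4 (λ q x y z → q :* (y :^ 8) :^ 3 :- q :* (x :^ 16 :* z :^ 8 :+ q :* (x :^ 8 :* z :^ 16))
        := (:- con 1F) :* (x :^ 8 :* y :^ 8 :- ((x :^ 8) :^ 3 :+ q :* (y :^ 8) :^ 3))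
           :+ (:- (x :^ 8 :* (y :^ 4 :+ x :^ 8 :- q :* z :^ 8))) :* (x :^ 8 :- (y :^ 4 :+ q :* z :^ 8))) refl X x y z))

    -- The cube is easier: α³ = ψ - qψ⁹, and inserting ψ = y²/x turns the claim into the relation
    -- between x⁸ and y⁸.
    αy²≈x⁵ : α * y ^ 2 ≈ x ^ 5
    αy²≈x⁵ = cube-injective (*-cancelˡ (x ^ 9) (1-^ {x} 9 x₀) (begin
      x ^ 9 * (α * y ^ 2) ^ 3
        ≈⟨ solve 5 (λ x y a p q → x :^ 9 :* (a :* y :^ 2) :^ 3 := x :^ 9 :* y :^ 6 :* ((a :^ 3 :+ q :* p) :- q :* p)) refl x y α ((ψ ^ 3) ^ 3) X ⟩
      x ^ 9 * y ^ 6 * ((α ^ 3 + X * (ψ ^ 3) ^ 3) - X * (ψ ^ 3) ^ 3)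
        ≈⟨ *-congˡ (+-congʳ (sym ψ-sections)) ⟩
      x ^ 9 * y ^ 6 * (ψ - X * (ψ ^ 3) ^ 3)
        ≈⟨ solve 4 (λ x y p q → x :^ 9 :* y :^ 6 :* (p :- q :* (p :^ 3) :^ 3) := x :^ 8 :* y :^ 6 :* (p :* x) :- q :* y :^ 6 :* (p :* x) :^ 9) refl x y ψ X ⟩
      x ^ 8 * y ^ 6 * (ψ * x) - X * y ^ 6 * (ψ * x) ^ 9
        ≈⟨ +-cong (*-congˡ ψx≈y²) (-‿cong (*-congˡ (^-congˡ 9 ψx≈y²))) ⟩
      x ^ 8 * y ^ 6 * y ^ 2 - X * y ^ 6 * (y ^ 2) ^ 9
        ≈⟨ linear₁ 1# x⁸y⁸≈x²⁴+Xy²⁴ (solve 3 (λ q x y → x :^ 8 :* y :^ 6 :* y :^ 2 :- q :* y :^ 6 :* (y :^ 2) :^ 9 :- x :^ 9 :* (x :^ 5) :^ 3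
             := con 1F :* (x :^ 8 :* y :^ 8 :- ((x :^ 8) :^ 3 :+ q :* (y :^ 8) :^ 3))) refl X x y) ⟩
      x ^ 9 * (x ^ 5) ^ 3 ∎))
      where open ≈-Reasoning

    ψ₂y≈z² : ψ₂ * y ≈ z ^ 2
    ψ₂y≈z² = trans (sym (expand₂-* ψ x)) (trans (expand₂-cong ψx≈y²) (expand₂-^ y 2))

    ψ₂-sections : ψ₂ ≈ α₂ ^ 3 + X ^ 2 * (ψ₂ ^ 3) ^ 3
    ψ₂-sections = begin
      ψ₂                                            ≈⟨ expand₂-cong ψ-sections ⟩
      expand₂ (α ^ 3 + X * (ψ ^ 3) ^ 3)             ≈⟨ expand₂-+ (α ^ 3) (X * (ψ ^ 3) ^ 3) ⟩
      expand₂ (α ^ 3) + expand₂ (X * (ψ ^ 3) ^ 3)   ≈⟨ +-cong (expand₂-^ α 3) (trans (expand₂-* X ((ψ ^ 3) ^ 3)) (*-cong expand₂-X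
                                                         (trans (expand₂-^ (ψ ^ 3) 3) (^-congˡ 3 (expand₂-^ ψ 3))))) ⟩
      α₂ ^ 3 + X ^ 2 * (ψ₂ ^ 3) ^ 3                 ∎
      where open ≈-Reasoning

    -- The exponents of ψ lie in the classes 0 and 1, those of ψ₂ in 0 and 2. Class 2 of the product
    -- arises only as 0 + 2.
    U₂[ψψ₂] : U 2 (ψ * ψ₂) ≈ α * ψ₂ ^ 3
    U₂[ψψ₂] = trans (U-cong 2 (trans (*-cong ψ-sections ψ₂-sections)
      (solve 5 (λ q a p c r → (a :^ 3 :+ q :* p :^ 3) :* (c :^ 3 :+ q :^ 2 :* r :^ 3)
        := (a :* c :+ q :* p :* r) :^ 3 :+ q :* (p :* c) :^ 3 :+ q :* (q :* (a :* r) :^ 3)) refl X α (ψ ^ 3) α₂ (ψ₂ ^ 3))))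
      (U₂-sections (α * α₂ + X * ψ ^ 3 * ψ₂ ^ 3) (ψ ^ 3 * α₂) (α * ψ₂ ^ 3))

    -- Multiplying Gauss's identities gives xy = ψφ. Both factors live in the classes 0 and 1, so
    -- class 0 is a single product.
    U₀[xy] : U 0 (x * y) ≈ α * φ ^ 3
    U₀[xy] = trans (U-cong 0 (trans (sym ψφ≈xy) (trans (*-cong ψ-sections φ-sections)
      (solve 5 (λ q a p f b → (a :^ 3 :+ q :* p :^ 3) :* (f :^ 3 :+ q :* b :^ 3)
        := (a :* f) :^ 3 :+ q :* (p :* f :+ a :* b) :^ 3 :+ q :* (q :* (p :* b) :^ 3)) refl X α (ψ ^ 3) (φ ^ 3) β))))
      (U₀-sections (α * φ ^ 3) (ψ ^ 3 * φ ^ 3 + α * β) (ψ ^ 3 * β))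
      where
      open ≈-Reasoning
      ψφ≈xy : ψ * φ ≈ x * y
      ψφ≈xy = *-cancelˡ (x * y) (1-* {x} {y} x₀ x₀) (begin
        x * y * (ψ * φ)       ≈⟨ solve 4 (λ x y p f → x :* y :* (p :* f) := (p :* x) :* (f :* y)) refl x y ψ φ ⟩
        (ψ * x) * (φ * y)     ≈⟨ *-cong ψx≈y² φy≈x² ⟩
        y ^ 2 * x ^ 2         ≈⟨ solve 2 (λ x y → y :^ 2 :* x :^ 2 := x :* y :* (x :* y)) refl x y ⟩
        x * y * (x * y)       ∎)

    -- The remainders once cubes are split off: x⁷z⁵ = v³u and x⁵z⁷ = u³v.
    u v : Series
    u = x * z ^ 2
    v = x ^ 2 * z

    -- Multiplying x⁸ = y⁴ + qz⁸ by x gives x⁹ = y³(xy) + q(z²)³u. Under `U 0` the left side is x³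
    -- and `U 0 (x * y)` is known, so the equation can be solved for `U 2 u`.
    y⁴U₂u : y ^ 4 * U 2 u ≈ - (x ^ 3 * z ^ 6)
    y⁴U₂u = *-cancelˡ (z ^ 2) (1-^ {z} 2 x₀) (X*-cancel (begin
      X * (z ^ 2 * (y ^ 4 * U 2 u))
        ≈⟨ linear₁ (- y ^ 4) split (solve 6 (λ q x y z t u → q :* (z :^ 2 :* (y :^ 4 :* u)) :- (y :^ 4 :* x :^ 3 :- y :^ 4 :* (y :* t))
             := (:- y :^ 4) :* (x :^ 3 :- (y :* t :+ q :* (z :^ 2 :* u)))) refl X x y z (U 0 (x * y)) (U 2 u)) ⟩
      y ^ 4 * x ^ 3 - y ^ 4 * (y * U 0 (x * y))  ≈⟨ +-congˡ (-‿cong (*-congˡ (*-congˡ U₀[xy]))) ⟩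
      y ^ 4 * x ^ 3 - y ^ 4 * (y * (α * φ ^ 3))
        ≈⟨ solve 4 (λ x y a f → y :^ 4 :* x :^ 3 :- y :^ 4 :* (y :* (a :* f :^ 3)) := y :^ 4 :* x :^ 3 :- (a :* y :^ 2) :* (f :* y) :^ 3) refl x y α φ ⟩
      y ^ 4 * x ^ 3 - (α * y ^ 2) * (φ * y) ^ 3  ≈⟨ +-congˡ (-‿cong (*-cong αy²≈x⁵ (^-congˡ 3 φy≈x²))) ⟩
      y ^ 4 * x ^ 3 - x ^ 5 * (x ^ 2) ^ 3
        ≈⟨ linear₁ (- x ^ 3) x⁸≈y⁴+Xz⁸ (solve 4 (λ q x y z → y :^ 4 :* x :^ 3 :- x :^ 5 :* (x :^ 2) :^ 3 :- q :* (z :^ 2 :* (:- (x :^ 3 :* z :^ 6)))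
             := (:- x :^ 3) :* (x :^ 8 :- (y :^ 4 :+ q :* z :^ 8))) refl X x y z) ⟩
      X * (z ^ 2 * - (x ^ 3 * z ^ 6)) ∎))
      where
      open ≈-Reasoning
      split : x ^ 3 ≈ y * U 0 (x * y) + X * (z ^ 2 * U 2 u)
      split = begin
        x ^ 3                                   ≈⟨ trans (*-congˡ U₀-1) (*-identityʳ (x ^ 3)) ⟨
        x ^ 3 * U 0 1#                          ≈⟨ U-cube-1 0 0<3 (x ^ 3) ⟨
        U 0 ((x ^ 3) ^ 3)
          ≈⟨ U-cong 0 (linear₁ x x⁸≈y⁴+Xz⁸ (solve 4 (λ q x y z → (x :^ 3) :^ 3 :- (y :^ 3 :* (x :* y) :+ q :* ((z :^ 2) :^ 3 :* (x :* z :^ 2)))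
               := x :* (x :^ 8 :- (y :^ 4 :+ q :* z :^ 8))) refl X x y z)) ⟩
        U 0 (y ^ 3 * (x * y) + X * ((z ^ 2) ^ 3 * u)) ≈⟨ U-+ 0 (y ^ 3 * (x * y)) (X * ((z ^ 2) ^ 3 * u)) ⟩
        U 0 (y ^ 3 * (x * y)) + U 0 (X * ((z ^ 2) ^ 3 * u))
          ≈⟨ +-cong (U-cube 0 0<3 y (x * y)) (trans (U₀-X ((z ^ 2) ^ 3 * u)) (*-congˡ (U-cube 2 2<3 (z ^ 2) u))) ⟩
        y * U 0 (x * y) + X * (z ^ 2 * U 2 u) ∎

    y²⁴-split : (y ^ 8) ^ 3 ≈ (x ^ 5 * z ^ 2) ^ 3 * u + X * ((x ^ 2 * z ^ 5) ^ 3 * v)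
    y²⁴-split = trans y²⁴≈x¹⁶z⁸+Xx⁸z¹⁶ (solve 3 (λ q x z → x :^ 16 :* z :^ 8 :+ q :* (x :^ 8 :* z :^ 16)
      := (x :^ 5 :* z :^ 2) :^ 3 :* (x :* z :^ 2) :+ q :* ((x :^ 2 :* z :^ 5) :^ 3 :* (x :^ 2 :* z))) refl X x z)

    -- A cube such as y²⁴ has no exponents in the classes 1 and 2. The factor q before the term with
    -- `v` lowers its class by one.
    U-relation : ∀ j → suc j < 3 → U (suc j) 1# ≈ 0# → 0# ≈ x ^ 5 * z ^ 2 * U (suc j) u + x ^ 2 * z ^ 5 * U j v
    U-relation j 1+j<3 U1≈0 = begin
      0#                              ≈⟨ zeroʳ (y ^ 8) ⟨
      y ^ 8 * 0#                      ≈⟨ *-congˡ U1≈0 ⟨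
      y ^ 8 * U (suc j) 1#            ≈⟨ U-cube-1 (suc j) 1+j<3 (y ^ 8) ⟨
      U (suc j) ((y ^ 8) ^ 3)         ≈⟨ U-cong (suc j) y²⁴-split ⟩
      U (suc j) ((x ^ 5 * z ^ 2) ^ 3 * u + X * ((x ^ 2 * z ^ 5) ^ 3 * v)) ≈⟨ U-+ (suc j) ((x ^ 5 * z ^ 2) ^ 3 * u) (X * ((x ^ 2 * z ^ 5) ^ 3 * v)) ⟩
      U (suc j) ((x ^ 5 * z ^ 2) ^ 3 * u) + U (suc j) (X * ((x ^ 2 * z ^ 5) ^ 3 * v))
        ≈⟨ +-cong (U-cube (suc j) 1+j<3 (x ^ 5 * z ^ 2) u) (trans (U-suc-X j ((x ^ 2 * z ^ 5) ^ 3 * v)) (U-cube j (ℕ.<-trans (ℕ.n<1+n j) 1+j<3) (x ^ 2 * z ^ 5) v)) ⟩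
      x ^ 5 * z ^ 2 * U (suc j) u + x ^ 2 * z ^ 5 * U j v ∎
      where open ≈-Reasoning

    module _ (B : Series) (Bxz³≈y² : B * (x * z ^ 3) ≈ y ^ 2) where

      -- For the generating function of b, the coefficients of `W`, `C` and `D` are b(3n), b(9n+6)
      -- and b(9n+3). The sign of `G` makes Gy⁶ the monomial x⁵z⁷.
      W C D G : Series
      W = U 0 B
      C = U 2 W
      D = U 1 W
      G = - U 2 C

      Wzy²≈x⁵ : W * (z * y ^ 2) ≈ x ^ 5
      Wzy²≈x⁵ = begin
        W * (z * y ^ 2)           ≈⟨ solve 3 (λ w y z → w :* (z :* y :^ 2) := z :* w :* y :^ 2) refl W y z ⟩
        z * W * y ^ 2             ≈⟨ *-congʳ (U-cube 0 0<3 z B) ⟨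
        U 0 (z ^ 3 * B) * y ^ 2   ≈⟨ *-congʳ (U-cong 0 z³B≈ψ) ⟩
        α * y ^ 2                 ≈⟨ αy²≈x⁵ ⟩
        x ^ 5                     ∎
        where
        open ≈-Reasoning
        z³B≈ψ : z ^ 3 * B ≈ ψ
        z³B≈ψ = *-cancelˡ x x₀ (begin
          x * (z ^ 3 * B)   ≈⟨ solve 3 (λ x z b → x :* (z :^ 3 :* b) := b :* (x :* z :^ 3)) refl x z B ⟩
          B * (x * z ^ 3)   ≈⟨ Bxz³≈y² ⟩
          y ^ 2             ≈⟨ ψx≈y² ⟨
          ψ * x             ≈⟨ *-comm ψ x ⟩
          x * ψ             ∎)

      -- From W = x⁵/(zy²) one gets (yz)³W = x⁵yz² = x⁶ · (y²/x) · (z²/y), which is a cube times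
      -- ψψ₂.
      Cy⁶≈x⁷z⁵ : C * y ^ 6 ≈ x ^ 7 * z ^ 5
      Cy⁶≈x⁷z⁵ = *-cancelˡ z x₀ (begin
        z * (C * y ^ 6)                 ≈⟨ solve 3 (λ c y z → z :* (c :* y :^ 6) := y :^ 5 :* (y :* z :* c)) refl C y z ⟩
        y ^ 5 * (y * z * C)             ≈⟨ *-congˡ (U-cube 2 2<3 (y * z) W) ⟨
        y ^ 5 * U 2 ((y * z) ^ 3 * W)   ≈⟨ *-congˡ (U-cong 2 W-theta) ⟩
        y ^ 5 * U 2 ((x ^ 2) ^ 3 * (ψ * ψ₂)) ≈⟨ *-congˡ (U-cube 2 2<3 (x ^ 2) (ψ * ψ₂)) ⟩
        y ^ 5 * (x ^ 2 * U 2 (ψ * ψ₂))  ≈⟨ *-congˡ (*-congˡ U₂[ψψ₂]) ⟩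
        y ^ 5 * (x ^ 2 * (α * ψ₂ ^ 3))  ≈⟨ solve 4 (λ x y a p → y :^ 5 :* (x :^ 2 :* (a :* p :^ 3)) := x :^ 2 :* (a :* y :^ 2) :* (p :* y) :^ 3) refl x y α ψ₂ ⟩
        x ^ 2 * (α * y ^ 2) * (ψ₂ * y) ^ 3 ≈⟨ *-cong (*-congˡ αy²≈x⁵) (^-congˡ 3 ψ₂y≈z²) ⟩
        x ^ 2 * x ^ 5 * (z ^ 2) ^ 3     ≈⟨ solve 2 (λ x z → x :^ 2 :* x :^ 5 :* (z :^ 2) :^ 3 := z :* (x :^ 7 :* z :^ 5)) refl x z ⟩
        z * (x ^ 7 * z ^ 5)             ∎)
        where
        open ≈-Reasoning
        W-theta : (y * z) ^ 3 * W ≈ (x ^ 2) ^ 3 * (ψ * ψ₂)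
        W-theta = *-cancelˡ (x * y ^ 3 * z) (1-* {x * y ^ 3} {z} (1-* {x} {y ^ 3} x₀ (1-^ {y} 3 x₀)) x₀) (begin
          x * y ^ 3 * z * ((y * z) ^ 3 * W)
            ≈⟨ solve 4 (λ x y z w → x :* y :^ 3 :* z :* ((y :* z) :^ 3 :* w) := x :* y :^ 4 :* z :^ 3 :* (w :* (z :* y :^ 2))) refl x y z W ⟩
          x * y ^ 4 * z ^ 3 * (W * (z * y ^ 2))    ≈⟨ *-congˡ Wzy²≈x⁵ ⟩
          x * y ^ 4 * z ^ 3 * x ^ 5
            ≈⟨ solve 3 (λ x y z → x :* y :^ 4 :* z :^ 3 :* x :^ 5 := (x :^ 2) :^ 3 :* y :^ 2 :* z :* (y :^ 2 :* z :^ 2)) refl x y z ⟩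
          (x ^ 2) ^ 3 * y ^ 2 * z * (y ^ 2 * z ^ 2)   ≈⟨ *-congˡ (*-cong ψx≈y² ψ₂y≈z²) ⟨
          (x ^ 2) ^ 3 * y ^ 2 * z * (ψ * x * (ψ₂ * y))
            ≈⟨ solve 5 (λ x y z p r → (x :^ 2) :^ 3 :* y :^ 2 :* z :* (p :* x :* (r :* y)) := x :* y :^ 3 :* z :* ((x :^ 2) :^ 3 :* (p :* r))) refl x y z ψ ψ₂ ⟩
          x * y ^ 3 * z * ((x ^ 2) ^ 3 * (ψ * ψ₂)) ∎)

      Gy⁶≈x⁵z⁷ : G * y ^ 6 ≈ x ^ 5 * z ^ 7
      Gy⁶≈x⁵z⁷ = begin
        - U 2 C * y ^ 6                     ≈⟨ solve 2 (λ c y → (:- c) :* y :^ 6 := :- (y :^ 4 :* (y :^ 2 :* c))) refl (U 2 C) y ⟩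
        - (y ^ 4 * (y ^ 2 * U 2 C))         ≈⟨ -‿cong (*-congˡ (U-cube 2 2<3 (y ^ 2) C)) ⟨
        - (y ^ 4 * U 2 ((y ^ 2) ^ 3 * C))   ≈⟨ -‿cong (*-congˡ (U-cong 2 (trans (solve 2 (λ c y → (y :^ 2) :^ 3 :* c := c :* y :^ 6) refl C y)
                                                 (trans Cy⁶≈x⁷z⁵ (solve 2 (λ x z → x :^ 7 :* z :^ 5 := (x :^ 2 :* z) :^ 3 :* (x :* z :^ 2)) refl x z))))) ⟩
        - (y ^ 4 * U 2 (v ^ 3 * u))         ≈⟨ -‿cong (*-congˡ (U-cube 2 2<3 v u)) ⟩
        - (y ^ 4 * (v * U 2 u))             ≈⟨ solve 4 (λ x y z u → :- (y :^ 4 :* (x :^ 2 :* z :* u)) := :- (x :^ 2 :* z :* (y :^ 4 :* u))) refl x y z (U 2 u) ⟩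
        - (v * (y ^ 4 * U 2 u))             ≈⟨ -‿cong (*-congˡ y⁴U₂u) ⟩
        - (v * - (x ^ 3 * z ^ 6))           ≈⟨ solve 2 (λ x z → :- (x :^ 2 :* z :* (:- (x :^ 3 :* z :^ 6))) := x :^ 5 :* z :^ 7) refl x z ⟩
        x ^ 5 * z ^ 7                       ∎
        where open ≈-Reasoning

      y²UG : ∀ j → j < 3 → y ^ 2 * U j G ≈ u * U j v
      y²UG j j<3 = begin
        y ^ 2 * U j G           ≈⟨ U-cube j j<3 (y ^ 2) G ⟨
        U j ((y ^ 2) ^ 3 * G)   ≈⟨ U-cong j (trans (solve 2 (λ g y → (y :^ 2) :^ 3 :* g := g :* y :^ 6) refl G y)
                                     (trans Gy⁶≈x⁵z⁷ (solve 2 (λ x z → x :^ 5 :* z :^ 7 := (x :* z :^ 2) :^ 3 :* (x :^ 2 :* z)) refl x z))) ⟩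
        U j (u ^ 3 * v)         ≈⟨ U-cube j j<3 u v ⟩
        u * U j v               ∎
        where open ≈-Reasoning

      -- Since Gy⁶ = u³v, this asks for `U 1 v`, which `U-relation` trades for the known `U 2 u`.
      U₁G≈C : U 1 G ≈ C
      U₁G≈C = *-cancelˡ (x * z ^ 3 * y ^ 6) (1-* {x * z ^ 3} {y ^ 6} (1-* {x} {z ^ 3} x₀ (1-^ {z} 3 x₀)) (1-^ {y} 6 x₀)) (begin
        x * z ^ 3 * y ^ 6 * U 1 G
          ≈⟨ solve 4 (λ x y z g → x :* z :^ 3 :* y :^ 6 :* g := x :* z :^ 3 :* y :^ 4 :* (y :^ 2 :* g)) refl x y z (U 1 G) ⟩
        x * z ^ 3 * y ^ 4 * (y ^ 2 * U 1 G)      ≈⟨ *-congˡ (y²UG 1 1<3) ⟩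
        x * z ^ 3 * y ^ 4 * (u * U 1 v)
          ≈⟨ linear₁ (- y ^ 4) (U-relation 1 2<3 U₂-1) (solve 5 (λ x y z r s → x :* z :^ 3 :* y :^ 4 :* (x :* z :^ 2 :* s) :- (:- (x :^ 5 :* z :^ 2 :* (y :^ 4 :* r)))
               := (:- y :^ 4) :* (con 0F :- (x :^ 5 :* z :^ 2 :* r :+ x :^ 2 :* z :^ 5 :* s))) refl x y z (U 2 u) (U 1 v)) ⟩
        - (x ^ 5 * z ^ 2 * (y ^ 4 * U 2 u))      ≈⟨ -‿cong (*-congˡ y⁴U₂u) ⟩
        - (x ^ 5 * z ^ 2 * - (x ^ 3 * z ^ 6))
          ≈⟨ solve 2 (λ x z → :- (x :^ 5 :* z :^ 2 :* (:- (x :^ 3 :* z :^ 6))) := x :* z :^ 3 :* (x :^ 7 :* z :^ 5)) refl x z ⟩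
        x * z ^ 3 * (x ^ 7 * z ^ 5)              ≈⟨ *-congˡ Cy⁶≈x⁷z⁵ ⟨
        x * z ^ 3 * (C * y ^ 6)                  ≈⟨ solve 4 (λ x y z c → x :* z :^ 3 :* (c :* y :^ 6) := x :* z :^ 3 :* y :^ 6 :* c) refl x y z C ⟩
        x * z ^ 3 * y ^ 6 * C                    ∎)
        where open ≈-Reasoning

      -- Neither side is computed. In W + qG the relation x⁸ = y⁴ + qz⁸ applies, so `D + U 0 G` is a
      -- multiple of `U 1 u`; `U-relation` makes `U 0 G` another one. Eliminating `U 1 u` leaves D +
      -- 2 `U 0 G` = 0, and 2 = -1.
      D≈U₀G : D ≈ U 0 G
      D≈U₀G = *-cancelˡ (x * z ^ 3 * y ^ 2) (1-* {x * z ^ 3} {y ^ 2} (1-* {x} {z ^ 3} x₀ (1-^ {z} 3 x₀)) (1-^ {y} 2 x₀))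
        (linear₂ (x * z ^ 2) (- 1#) y²z[D+U₀G] relation
          (solve 6 (λ x y z d g r → x :* z :^ 3 :* y :^ 2 :* d :- x :* z :^ 3 :* y :^ 2 :* g
            := x :* z :^ 2 :* (y :^ 2 :* z :* (d :+ g) :- x :^ 4 :* r) :+ (:- con 1F) :* (con 0F :- (x :^ 5 :* z :^ 2 :* r :+ x :* z :^ 3 :* (y :^ 2 :* g)))) refl x y z D (U 0 G) (U 1 u)))
        where
        open ≈-Reasoning
        relation : 0# ≈ x ^ 5 * z ^ 2 * U 1 u + x * z ^ 3 * (y ^ 2 * U 0 G)
        relation = begin
          0#                                                        ≈⟨ U-relation 0 1<3 U₁-1 ⟩
          x ^ 5 * z ^ 2 * U 1 u + x ^ 2 * z ^ 5 * U 0 v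
            ≈⟨ solve 4 (λ x z r s → x :^ 5 :* z :^ 2 :* r :+ x :^ 2 :* z :^ 5 :* s := x :^ 5 :* z :^ 2 :* r :+ x :* z :^ 3 :* (x :* z :^ 2 :* s)) refl x z (U 1 u) (U 0 v) ⟩
          x ^ 5 * z ^ 2 * U 1 u + x * z ^ 3 * (u * U 0 v)           ≈⟨ +-congˡ (*-congˡ (y²UG 0 0<3)) ⟨
          x ^ 5 * z ^ 2 * U 1 u + x * z ^ 3 * (y ^ 2 * U 0 G)       ∎
        W+XG : (y ^ 2 * z) ^ 3 * (W + X * G) ≈ (x ^ 4) ^ 3 * u
        W+XG = begin
          (y ^ 2 * z) ^ 3 * (W + X * G)
            ≈⟨ solve 5 (λ q y z w g → (y :^ 2 :* z) :^ 3 :* (w :+ q :* g) := y :^ 4 :* z :^ 2 :* (w :* (z :* y :^ 2)) :+ q :* z :^ 3 :* (g :* y :^ 6)) refl X y z W G ⟩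
          y ^ 4 * z ^ 2 * (W * (z * y ^ 2)) + X * z ^ 3 * (G * y ^ 6)   ≈⟨ +-cong (*-congˡ Wzy²≈x⁵) (*-congˡ Gy⁶≈x⁵z⁷) ⟩
          y ^ 4 * z ^ 2 * x ^ 5 + X * z ^ 3 * (x ^ 5 * z ^ 7)
            ≈⟨ linear₁ (- (x ^ 5 * z ^ 2)) x⁸≈y⁴+Xz⁸ (solve 4 (λ q x y z → y :^ 4 :* z :^ 2 :* x :^ 5 :+ q :* z :^ 3 :* (x :^ 5 :* z :^ 7) :- (x :^ 4) :^ 3 :* (x :* z :^ 2)
                 := (:- (x :^ 5 :* z :^ 2)) :* (x :^ 8 :- (y :^ 4 :+ q :* z :^ 8))) refl X x y z) ⟩
          (x ^ 4) ^ 3 * u ∎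
        y²z[D+U₀G] : y ^ 2 * z * (D + U 0 G) ≈ x ^ 4 * U 1 u
        y²z[D+U₀G] = begin
          y ^ 2 * z * (D + U 0 G)                 ≈⟨ *-congˡ (+-congˡ (U-suc-X 0 G)) ⟨
          y ^ 2 * z * (D + U 1 (X * G))           ≈⟨ *-congˡ (U-+ 1 W (X * G)) ⟨
          y ^ 2 * z * U 1 (W + X * G)             ≈⟨ U-cube 1 1<3 (y ^ 2 * z) (W + X * G) ⟨
          U 1 ((y ^ 2 * z) ^ 3 * (W + X * G))     ≈⟨ U-cong 1 W+XG ⟩
          U 1 ((x ^ 4) ^ 3 * u)                   ≈⟨ U-cube 1 1<3 (x ^ 4) u ⟩
          x ^ 4 * U 1 u                           ∎

      U₁U₂C≈-C : U 1 (U 2 C) ≈ - C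
      U₁U₂C≈-C = trans (neg-swap (U-neg 1 (U 2 C))) (-‿cong U₁G≈C)

      U₀U₂C≈-D : U 0 (U 2 C) ≈ - D
      U₀U₂C≈-D = trans (neg-swap (U-neg 0 (U 2 C))) (-‿cong (sym D≈U₀G))

-- Listing the partitions by their largest allowed part

linked-∷ : ∀ {h π} → All (_≤ h) π → Linked _≥_ π → Linked _≥_ (h ∷ π)
linked-∷ []      []  = [-]
linked-∷ (p ∷ _) lk = p ∷ lk

linked-head : ∀ {h π} → Linked _≥_ (h ∷ π) → All (_≤ h) π
linked-head lk = AllPairs.head (Linked⇒AllPairs (λ p q → ℕ.≤-trans q p) lk)

parts≤sum : ∀ π → All (_≤ sum π) π
parts≤sum []      = []
parts≤sum (h ∷ π) = ℕ.m≤m+n h (sum π) ∷ All.map (λ p≤s → ℕ.≤-trans p≤s (ℕ.m≤n+m (sum π) h)) (parts≤sum π)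

length≤sum : ∀ {π} → All (0 <_) π → length π ≤ sum π
length≤sum []         = z≤n
length≤sum (h>0 ∷ ps) = ℕ.+-mono-≤ h>0 (length≤sum ps)

-- The two halves differ in whether the part 2m + 1 is used, which is the choice made by one factor
-- of the product.
oddDistinctPartitions : ℕ → List (List ℕ)
oddDistinctPartitions zero    = [] ∷ []
oddDistinctPartitions (suc m) = oddDistinctPartitions m ++ map (suc (m ℕ.* 2) ∷_) (oddDistinctPartitions m)

2∤odd : ∀ m → 2 ∤ suc (m ℕ.* 2)
2∤odd m 2∣ with ∣1⇒≡1 (∣m+n∣m⇒∣n (≡.subst (2 ∣_) (ℕ.+-comm 1 (m ℕ.* 2)) 2∣) (n∣m*n m))
... | ()

odd-≢ : ∀ {p} m → 2 ∤ p → p ≢ m ℕ.* 2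
odd-≢ m 2∤p ≡.refl = 2∤p (n∣m*n m)

oddDistinct-sound : ∀ m {π} → π ∈ oddDistinctPartitions m → IsPartition π × DistinctOddParts π × All (_< m ℕ.* 2) π
oddDistinct-sound zero    (here ≡.refl) = ([] , []) , ([] , []) , []
oddDistinct-sound (suc m) π∈ with ∈-++⁻ (oddDistinctPartitions m) π∈
... | inj₁ π∈′ = let part , dist , bound = oddDistinct-sound m π∈′ in
  part , dist , All.map (λ p< → ℕ.<-≤-trans p< (ℕ.m≤n+m (m ℕ.* 2) 2)) bound
... | inj₂ π∈′ with ∈-map⁻ (suc (m ℕ.* 2) ∷_) π∈′
... | π , π∈ , ≡.refl = let (pos , lk) , (uq , odd) , bound = oddDistinct-sound m π∈ in
  (s≤s z≤n ∷ pos , linked-∷ (All.map (λ p< → ℕ.m≤n⇒m≤1+n (ℕ.<⇒≤ p<)) bound) lk) ,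
  (All.map (λ p< → ℕ.>⇒≢ (ℕ.m<n⇒m<1+n p<)) bound ∷ uq , 2∤odd m ∷ odd) ,
  ℕ.≤-refl ∷ All.map (λ p< → ℕ.<-≤-trans p< (ℕ.m≤n+m (m ℕ.* 2) 2)) bound

oddDistinct-complete : ∀ m {π} → IsPartition π → DistinctOddParts π → All (_< m ℕ.* 2) π → π ∈ oddDistinctPartitions m
oddDistinct-complete zero    {[]}    _ _ _ = here ≡.refl
oddDistinct-complete zero    {_ ∷ _} _ _ (() ∷ _)
oddDistinct-complete (suc m) {[]}    p d _ = ∈-++⁺ˡ (oddDistinct-complete m p d [])
oddDistinct-complete (suc m) {h ∷ π} (pos , lk) (h∉ ∷ uq , 2∤h ∷ odd) (s≤s h≤ ∷ bound) with h ℕ.<? m ℕ.* 2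
... | yes h< = ∈-++⁺ˡ (oddDistinct-complete m (pos , lk) (h∉ ∷ uq , 2∤h ∷ odd)
  (h< ∷ All.map (λ p≤h → ℕ.≤-<-trans p≤h h<) (linked-head lk)))
-- The bound gives `h` ≤ 2m + 1, and `h` = 2m is excluded by parity, so `h` is the new part.
... | no h≮ with ℕ.≤-antisym h≤ (ℕ.≤∧≢⇒< (ℕ.≮⇒≥ h≮) (λ eq → odd-≢ m 2∤h (≡.sym eq)))
... | ≡.refl = ∈-++⁺ʳ (oddDistinctPartitions m) (∈-map⁺ (suc (m ℕ.* 2) ∷_)
  (oddDistinct-complete m (All.tail pos , Linked.tail lk) (uq , odd) (All.tabulate small)))
  where
  small : ∀ {p} → p ∈ π → p < m ℕ.* 2
  -- Distinctness puts `p` below 2m + 1, and parity excludes 2m.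
  small p∈ = ℕ.≤∧≢⇒< (ℕ.s≤s⁻¹ (ℕ.≤∧≢⇒< (All.lookup (linked-head lk) p∈) (λ eq → All.lookup h∉ p∈ (≡.sym eq)))) (odd-≢ m (All.lookup odd p∈))

oddDistinct-unique : ∀ m → Unique (oddDistinctPartitions m)
oddDistinct-unique zero    = [] ∷ []
oddDistinct-unique (suc m) = Unique.++⁺ (oddDistinct-unique m) (Unique.map⁺ ∷-injectiveʳ (oddDistinct-unique m)) disjoint
  where
  disjoint : ∀ {π} → π ∈ oddDistinctPartitions m × π ∈ map (suc (m ℕ.* 2) ∷_) (oddDistinctPartitions m) → _
  disjoint (π∈ , π∈′) with ∈-map⁻ (suc (m ℕ.* 2) ∷_) π∈′
  ... | _ , _ , ≡.refl = ℕ.<⇒≱ (All.head (proj₂ (proj₂ (oddDistinct-sound m π∈)))) (ℕ.n≤1+n (m ℕ.* 2))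

-- Parts may repeat, so `l` bounds their number to keep the list finite. Using the part 4(m + 1)
-- lowers `l` and not `m`.
4-partitions : ℕ → ℕ → List (List ℕ)
4-partitions zero    l       = [] ∷ []
4-partitions (suc m) zero    = [] ∷ []
4-partitions (suc m) (suc l) = 4-partitions m (suc l) ++ map (suc m ℕ.* 4 ∷_) (4-partitions (suc m) l)

4-sound : ∀ m l {π} → π ∈ 4-partitions m l → IsPartition π × PartsDivisibleBy4 π × All (_≤ m ℕ.* 4) π
4-sound zero    l       (here ≡.refl) = ([] , []) , [] , []
4-sound (suc m) zero    (here ≡.refl) = ([] , []) , [] , []
4-sound (suc m) (suc l) π∈ with ∈-++⁻ (4-partitions m (suc l)) π∈
... | inj₁ π∈′ = let part , div , bound = 4-sound m (suc l) π∈′ in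
  part , div , All.map (λ p≤ → ℕ.≤-trans p≤ (ℕ.m≤n+m (m ℕ.* 4) 4)) bound
... | inj₂ π∈′ with ∈-map⁻ (suc m ℕ.* 4 ∷_) π∈′
... | π , π∈ , ≡.refl = let (pos , lk) , div , bound = 4-sound (suc m) l π∈ in
  (s≤s z≤n ∷ pos , linked-∷ bound lk) , n∣m*n (suc m) ∷ div , ℕ.≤-refl ∷ bound

4-complete : ∀ m l {π} → IsPartition π → PartsDivisibleBy4 π → All (_≤ m ℕ.* 4) π → length π ≤ l → π ∈ 4-partitions m l
4-complete zero    l       {[]}    _ _ _ _ = here ≡.refl
4-complete zero    l       {h ∷ π} (h>0 ∷ _ , _) _ (h≤0 ∷ _) _ = contradiction h>0 (ℕ.≤⇒≯ h≤0)
4-complete (suc m) zero    {[]}    _ _ _ _ = here ≡.refl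
4-complete (suc m) (suc l) {[]}    p d _ _ = ∈-++⁺ˡ (4-complete m (suc l) p d [] z≤n)
4-complete (suc m) (suc l) {h ∷ π} (pos , lk) (4∣h ∷ div) (h≤ ∷ bound) (s≤s len) with h ℕ.≤? m ℕ.* 4
... | yes h≤4m = ∈-++⁺ˡ (4-complete m (suc l) (pos , lk) (4∣h ∷ div)
  (h≤4m ∷ All.map (λ p≤h → ℕ.≤-trans p≤h h≤4m) (linked-head lk)) (s≤s len))
... | no h≰4m with 4∣h
-- With `h` = 4k, the bounds 4m < 4k ≤ 4(m + 1) force k = m + 1.
... | divides k ≡.refl with ℕ.≤-antisym (ℕ.*-cancelʳ-≤ k (suc m) 4 h≤) (ℕ.*-cancelʳ-< 4 m k (ℕ.≰⇒> h≰4m))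
... | ≡.refl = ∈-++⁺ʳ (4-partitions m (suc l)) (∈-map⁺ (suc m ℕ.* 4 ∷_)
  (4-complete (suc m) l (All.tail pos , Linked.tail lk) div bound len))

4-unique : ∀ m l → Unique (4-partitions m l)
4-unique zero    l       = [] ∷ []
4-unique (suc m) zero    = [] ∷ []
4-unique (suc m) (suc l) = Unique.++⁺ (4-unique m (suc l)) (Unique.map⁺ ∷-injectiveʳ (4-unique (suc m) l)) disjoint
  where
  disjoint : ∀ {π} → π ∈ 4-partitions m (suc l) × π ∈ map (suc m ℕ.* 4 ∷_) (4-partitions (suc m) l) → _
  disjoint (π∈ , π∈′) with ∈-map⁻ (suc m ℕ.* 4 ∷_) π∈′
  ... | _ , _ , ≡.refl = ℕ.<⇒≱ (ℕ.m<n+m (m ℕ.* 4) {4} (s≤s z≤n)) (All.head (proj₂ (proj₂ (4-sound m (suc l) π∈))))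

-- The size is not fixed, so this is a full product and its generating function factors.
candidates : ℕ → List Triple
candidates m = cartesianProduct (oddDistinctPartitions m) (cartesianProduct (4-partitions m m) (4-partitions m m))

-- Both lists are free of repetitions and have the same members, hence are permutations of each
-- other. Parts and numbers of parts are at most `n` < `m`, so the bounds on the candidates exclude
-- nothing.
b≡count : ∀ n m → n < m → b n ≡ length (filter (λ t → size t ℕ.≟ n) (candidates m))
b≡count n m n<m = ↭-length (∼bag⇒↭ (unique∧set⇒bag (triples-unique n) unique-candidates (mk⇔ to from)))
  where
  D F : List (List ℕ)
  D = oddDistinctPartitions m
  F = 4-partitions m m

  unique-candidates : Unique (filter (λ t → size t ℕ.≟ n) (candidates m))
  unique-candidates = Unique.filter⁺ (λ t → size t ℕ.≟ n)
    (Unique.cartesianProduct⁺ (oddDistinct-unique m) (Unique.cartesianProduct⁺ (4-unique m m) (4-unique m m)))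

  ≤n⇒4m : ∀ {p s} → s ≤ n → p ≤ s → p ≤ m ℕ.* 4
  ≤n⇒4m s≤n p≤s = ℕ.≤-trans p≤s (ℕ.≤-trans s≤n (ℕ.≤-trans (ℕ.<⇒≤ n<m) (ℕ.m≤m*n m 4)))

  in-F : ∀ {π} → IsPartition π → PartsDivisibleBy4 π → sum π ≤ n → π ∈ F
  in-F {π} p d s≤n = 4-complete m m p d (All.map (≤n⇒4m s≤n) (parts≤sum π))
    (ℕ.≤-trans (length≤sum (proj₁ p)) (ℕ.≤-trans s≤n (ℕ.<⇒≤ n<m)))

  to : ∀ {t} → t ∈ triples n → t ∈ filter (λ t → size t ℕ.≟ n) (candidates m)
  to {t@(π₁ , π₂ , π₃)} t∈ with Equivalence.to (∈-triples n t) t∈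
  ... | admissible p₁ p₂ p₃ eq d₁ d₂ d₃ = ∈-filter⁺ (λ t → size t ℕ.≟ n)
    (∈-cartesianProduct⁺ (oddDistinct-complete m p₁ d₁ (All.map (λ p≤s → ℕ.≤-<-trans p≤s (ℕ.≤-<-trans s₁ (ℕ.<-≤-trans n<m (ℕ.m≤m*n m 2)))) (parts≤sum π₁)))
      (∈-cartesianProduct⁺ (in-F p₂ d₂ s₂) (in-F p₃ d₃ s₃))) eq
    where
    s₁ : sum π₁ ≤ n
    s₁ = ℕ.≤-trans (ℕ.m≤m+n (sum π₁) _) (ℕ.≤-reflexive eq)
    s₂₃ : sum π₂ ℕ.+ sum π₃ ≤ n
    s₂₃ = ℕ.≤-trans (ℕ.m≤n+m _ (sum π₁)) (ℕ.≤-reflexive eq)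
    s₂ : sum π₂ ≤ n
    s₂ = ℕ.≤-trans (ℕ.m≤m+n (sum π₂) _) s₂₃
    s₃ : sum π₃ ≤ n
    s₃ = ℕ.≤-trans (ℕ.m≤n+m _ (sum π₂)) s₂₃

  from : ∀ {t} → t ∈ filter (λ t → size t ℕ.≟ n) (candidates m) → t ∈ triples n
  from {t@(π₁ , π₂ , π₃)} t∈ =
    let t∈′ , eq = ∈-filter⁻ (λ t → size t ℕ.≟ n) {xs = candidates m} t∈
        π₁∈ , π₂₃∈ = ∈-cartesianProduct⁻ D (cartesianProduct F F) t∈′
        π₂∈ , π₃∈ = ∈-cartesianProduct⁻ F F π₂₃∈
        p₁ , d₁ , _ = oddDistinct-sound m π₁∈
        p₂ , d₂ , _ = 4-sound m m π₂∈
        p₃ , d₃ , _ = 4-sound m m π₃∈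
    in Equivalence.from (∈-triples n t) (admissible p₁ p₂ p₃ eq d₁ d₂ d₃)

-- The generating function of b modulo 3

module GeneratingFunction where

  open PowerSeries
  open QSeries

  ⌊_⌋₃ : ℕ → 𝔽₃
  ⌊ zero ⌋₃  = 0F
  ⌊ suc n ⌋₃ = 1F 𝔽₃.+ ⌊ n ⌋₃

  X^-coeff-≡ : ∀ k → (X ^ k) k ≡ 1F
  X^-coeff-≡ zero    = ≡.refl
  X^-coeff-≡ (suc k) = ≡.trans (X*-suc (X ^ k) k) (X^-coeff-≡ k)

  X^-coeff-≢ : ∀ k n → k ≢ n → (X ^ k) n ≡ 0F
  X^-coeff-≢ zero    zero    k≢n = contradiction ≡.refl k≢n
  X^-coeff-≢ zero    (suc n) k≢n = ≡.refl
  X^-coeff-≢ (suc k) zero    k≢n = X*-zero (X ^ k)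
  X^-coeff-≢ (suc k) (suc n) k≢n = ≡.trans (X*-suc (X ^ k) n) (X^-coeff-≢ k n (λ eq → k≢n (cong suc eq)))

  gf : {A : Set} → (A → ℕ) → List A → Series
  gf s []       = 0#
  gf s (a ∷ as) = X ^ s a + gf s as

  opaque
    unfolding _⊞_

    gf-coeff : ∀ {A : Set} (s : A → ℕ) as n → gf s as n ≡ ⌊ length (filter (λ a → s a ℕ.≟ n) as) ⌋₃
    gf-coeff s []       zero    = ≡.refl
    gf-coeff s []       (suc n) = ≡.refl
    gf-coeff s (a ∷ as) n with s a ℕ.≟ n
    ... | yes ≡.refl = ≡.trans (cong₂ 𝔽₃._+_ (X^-coeff-≡ (s a)) (gf-coeff s as (s a)))
                         (cong (λ as → ⌊ length as ⌋₃) (≡.sym (filter-accept (λ a′ → s a′ ℕ.≟ s a) ≡.refl)))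
    ... | no sa≢n    = ≡.trans (cong₂ 𝔽₃._+_ (X^-coeff-≢ (s a) n sa≢n) (gf-coeff s as n))
                         (cong (λ as → ⌊ length as ⌋₃) (≡.sym (filter-reject (λ a → s a ℕ.≟ n) sa≢n)))

  gf-++ : ∀ {A : Set} (s : A → ℕ) as bs → gf s (as ++ bs) ≈ gf s as + gf s bs
  gf-++ s []       bs = sym (+-identityˡ (gf s bs))
  gf-++ s (a ∷ as) bs = trans (+-congˡ (gf-++ s as bs)) (sym (+-assoc (X ^ s a) (gf s as) (gf s bs)))

  gf-map : ∀ {A B : Set} (s : A → ℕ) (t : B → ℕ) k (g : A → B) → (∀ a → t (g a) ≡ k ℕ.+ s a) → ∀ as → gf t (map g as) ≈ X ^ k * gf s as
  gf-map s t k g eq []       = sym (zeroʳ (X ^ k))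
  gf-map s t k g eq (a ∷ as) = begin
    X ^ t (g a) + gf t (map g as)          ≈⟨ +-cong (trans (^-congʳ X (eq a)) (^-homo-* X k (s a))) (gf-map s t k g eq as) ⟩
    X ^ k * X ^ s a + X ^ k * gf s as      ≈⟨ distribˡ (X ^ k) (X ^ s a) (gf s as) ⟨
    X ^ k * (X ^ s a + gf s as)            ∎
    where open ≈-Reasoning

  gf-cartesianProduct : ∀ {A B : Set} (s : A → ℕ) (t : B → ℕ) (w : A × B → ℕ) → (∀ a b → w (a , b) ≡ s a ℕ.+ t b) →
                        ∀ as bs → gf w (cartesianProduct as bs) ≈ gf s as * gf t bs
  gf-cartesianProduct s t w eq []       bs = sym (zeroˡ (gf t bs))
  gf-cartesianProduct s t w eq (a ∷ as) bs = begin
    gf w (map (a ,_) bs ++ cartesianProduct as bs)         ≈⟨ gf-++ w (map (a ,_) bs) (cartesianProduct as bs) ⟩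
    gf w (map (a ,_) bs) + gf w (cartesianProduct as bs)   ≈⟨ +-cong (gf-map t w (s a) (a ,_) (eq a) bs) (gf-cartesianProduct s t w eq as bs) ⟩
    X ^ s a * gf t bs + gf s as * gf t bs                  ≈⟨ distribʳ (gf t bs) (X ^ s a) (gf s as) ⟨
    (X ^ s a + gf s as) * gf t bs                          ∎
    where open ≈-Reasoning

  gf-oddDistinct : ∀ m → gf sum (oddDistinctPartitions m) ≈ poch (X ^ 2) (- X) m
  gf-oddDistinct zero    = +-identityʳ 1#
  gf-oddDistinct (suc m) = begin
    gf sum (oddDistinctPartitions m ++ map (suc (m ℕ.* 2) ∷_) (oddDistinctPartitions m))
      ≈⟨ gf-++ sum (oddDistinctPartitions m) (map (suc (m ℕ.* 2) ∷_) (oddDistinctPartitions m)) ⟩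
    gf sum (oddDistinctPartitions m) + gf sum (map (suc (m ℕ.* 2) ∷_) (oddDistinctPartitions m))
      ≈⟨ +-congˡ (gf-map sum sum (suc (m ℕ.* 2)) (suc (m ℕ.* 2) ∷_) (λ _ → ≡.refl) (oddDistinctPartitions m)) ⟩
    gf sum (oddDistinctPartitions m) + X ^ suc (m ℕ.* 2) * gf sum (oddDistinctPartitions m)
      ≈⟨ +-cong (gf-oddDistinct m) (*-cong (*-congˡ (trans (sym (^-assocʳ X m 2)) (^-swap X m 2))) (gf-oddDistinct m)) ⟩
    poch (X ^ 2) (- X) m + X * (X ^ 2) ^ m * poch (X ^ 2) (- X) m
      ≈⟨ solve 3 (λ x r p → p :+ x :* r :* p := p :* (con 1F :- r :* (:- x))) refl X ((X ^ 2) ^ m) (poch (X ^ 2) (- X) m) ⟩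
    poch (X ^ 2) (- X) m * (1# - (X ^ 2) ^ m * - X) ∎
    where open ≈-Reasoning

  poch₄ : ℕ → Series
  poch₄ = poch (X ^ 4) (X ^ 4)

  gf₄ : ℕ → ℕ → Series
  gf₄ m l = gf sum (4-partitions m l)

  opaque
    unfolding _⊞_

    poch₄-coeff-0 : ∀ m → poch₄ m 0 ≡ 1F
    poch₄-coeff-0 zero    = ≡.refl
    poch₄-coeff-0 (suc m) = cong₂ 𝔽₃._*_ (poch₄-coeff-0 m) (cong (λ c → 1F 𝔽₃.+ 𝔽₃.- c) (𝔽₃.*-zeroʳ (((X ^ 4) ^ m) 0)))

  -- Limiting the number of parts to `l` affects only sizes above `l`, hence the precision. Each
  -- recursion either gives up the part 4(m + 1) or uses one copy of it.
  poch₄*gf₄ : ∀ m l → poch₄ m * gf₄ m l ≈[ suc l ] 1#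
  poch₄*gf₄ zero    l       = ≈⇒≈[] (trans (*-identityˡ _) (+-identityʳ 1#))
  poch₄*gf₄ (suc m) zero    = ≈[]-trans (≈⇒≈[] (trans (*-congˡ (+-identityʳ 1#)) (*-identityʳ (poch₄ (suc m)))))
    (below λ { zero _ → poch₄-coeff-0 (suc m) ; (suc _) (s≤s ()) })
  poch₄*gf₄ (suc m) (suc l) = ≈[]-trans (≈⇒≈[] split)
    (≈[]-trans (+-cong-≈[] (*-cong-≈[] (≈⇒≈[] refl) (poch₄*gf₄ m (suc l)))
      -- Multiplication by `t` raises the precision l + 1 by 4(m + 1), more than the l + 2 required
      -- here.
      (≈[]-weaken (s≤s (s≤s (ℕ.m≤n⇒m≤1+n (ℕ.m≤n⇒m≤1+n (ℕ.m≤n⇒m≤o+n (m ℕ.* 4) (ℕ.n≤1+n l)))))) (X^*-cong-≈[] (suc m ℕ.* 4) (poch₄*gf₄ (suc m) l))))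
    (≈⇒≈[] (solve 1 (λ t → (con 1F :- t) :* con 1F :+ t :* con 1F := con 1F) refl t)))
    where
    open ≈-Reasoning
    t : Series
    t = X ^ (suc m ℕ.* 4)
    t≈ : (X ^ 4) ^ m * X ^ 4 ≈ t
    t≈ = trans (*-congʳ (trans (^-assocʳ X 4 m) (^-congʳ X (ℕ.*-comm 4 m)))) (trans (*-comm (X ^ (m ℕ.* 4)) (X ^ 4)) (sym (^-homo-* X 4 (m ℕ.* 4))))
    split : poch₄ (suc m) * gf₄ (suc m) (suc l) ≈ (1# - t) * (poch₄ m * gf₄ m (suc l)) + t * (poch₄ (suc m) * gf₄ (suc m) l)
    split = begin
      poch₄ m * (1# - (X ^ 4) ^ m * X ^ 4) * gf₄ (suc m) (suc l)
        ≈⟨ *-cong (*-congˡ (+-congˡ (-‿cong t≈))) (trans (gf-++ sum (4-partitions m (suc l)) (map (suc m ℕ.* 4 ∷_) (4-partitions (suc m) l)))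
             (+-congˡ (gf-map sum sum (suc m ℕ.* 4) (suc m ℕ.* 4 ∷_) (λ _ → ≡.refl) (4-partitions (suc m) l)))) ⟩
      poch₄ m * (1# - t) * (gf₄ m (suc l) + t * gf₄ (suc m) l)
        ≈⟨ solve 4 (λ P t g h → P :* (con 1F :- t) :* (g :+ t :* h) := (con 1F :- t) :* (P :* g) :+ t :* (P :* (con 1F :- t) :* h)) refl (poch₄ m) t (gf₄ m (suc l)) (gf₄ (suc m) l) ⟩
      (1# - t) * (poch₄ m * gf₄ m (suc l)) + t * (poch₄ m * (1# - t) * gf₄ (suc m) l)
        ≈⟨ +-congˡ (*-congˡ (*-congʳ (*-congˡ (+-congˡ (-‿cong (sym t≈)))))) ⟩
      (1# - t) * (poch₄ m * gf₄ m (suc l)) + t * (poch₄ (suc m) * gf₄ (suc m) l) ∎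

  f₄ : Series
  f₄ = expand₂ (expand₂ f₁)

  poch₄-converges : poch₄ ⟶ f₄
  poch₄-converges = ⟶-resp (⟶-expand₂ (⟶-expand₂ f₁-converges)) λ n → begin
    expand₂ (expand₂ (poch X X n))                        ≈⟨ expand₂-cong (expand₂-poch X X n) ⟩
    expand₂ (poch (expand₂ X) (expand₂ X) n)              ≈⟨ expand₂-poch (expand₂ X) (expand₂ X) n ⟩
    poch (expand₂ (expand₂ X)) (expand₂ (expand₂ X)) n    ≈⟨ poch-cong n X⁴ X⁴ ⟩
    poch₄ n                                               ∎
    where
    open ≈-Reasoning
    X⁴ : expand₂ (expand₂ X) ≈ X ^ 4
    X⁴ = trans (expand₂-cong expand₂-X) (trans (expand₂-^ X 2) (trans (^-congˡ 2 expand₂-X) (^-assocʳ X 2 2)))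

  B : Series
  B n = ⌊ b n ⌋₃

  gf-candidates : ∀ m → gf size (candidates m) ≈ gf sum (oddDistinctPartitions m) * (gf₄ m m * gf₄ m m)
  gf-candidates m = trans
    (gf-cartesianProduct sum (λ (π₂ , π₃) → sum π₂ ℕ.+ sum π₃) size (λ _ _ → ≡.refl) (oddDistinctPartitions m) (cartesianProduct (4-partitions m m) (4-partitions m m)))
    (*-congˡ (gf-cartesianProduct sum sum (λ (π₂ , π₃) → sum π₂ ℕ.+ sum π₃) (λ _ _ → ≡.refl) (4-partitions m m) (4-partitions m m)))

  candidates-converge : (λ m → gf size (candidates m)) ⟶ B
  candidates-converge = converges λ N → N , λ m N≤m → below λ i i<N →
    ≡.trans (gf-coeff size (candidates m) i) (cong ⌊_⌋₃ (≡.sym (b≡count i m (ℕ.<-≤-trans i<N N≤m))))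

  -- At stage `m` each of the two lists of multiples of 4 cancels one factor `poch₄ m` modulo
  -- `X ^ m`, so only the distinct odd parts remain.
  f₄²B≈oddDistinct : f₄ ^ 2 * B ≈ oddDistinct
  f₄²B≈oddDistinct = ⟶-unique (⟶-* (⟶-^ poch₄-converges 2) candidates-converge) (poch-converges (X * 1#) (- X) refl) λ m →
    ≈[]-trans (≈⇒≈[] (trans (*-congˡ (gf-candidates m)) (solve 3 (λ P g d → P :^ 2 :* (d :* (g :* g)) := d :* ((P :* g) :* (P :* g))) refl (poch₄ m) (gf₄ m m) (gf sum (oddDistinctPartitions m)))))
    (≈[]-trans (*-cong-≈[] (≈⇒≈[] (gf-oddDistinct m)) (*-cong-≈[] (1≈ m) (1≈ m)))
      (≈⇒≈[] (solve 1 (λ p → p :* (con 1F :* con 1F) := p) refl (poch (X ^ 2) (- X) m))))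
    where
    1≈ : ∀ m → poch₄ m * gf₄ m m ≈[ m ] 1#
    1≈ m = ≈[]-weaken (ℕ.n≤1+n m) (poch₄*gf₄ m m)

  Bf₁f₄³≈f₂² : B * (f₁ * f₄ ^ 3) ≈ expand₂ f₁ ^ 2
  Bf₁f₄³≈f₂² = begin
    B * (f₁ * f₄ ^ 3)             ≈⟨ solve 3 (λ b x z → b :* (x :* z :^ 3) := z :^ 2 :* b :* (x :* z)) refl B f₁ f₄ ⟩
    f₄ ^ 2 * B * (f₁ * f₄)        ≈⟨ *-congʳ f₄²B≈oddDistinct ⟩
    oddDistinct * (f₁ * f₄)       ≈⟨ oddDistinct-f₁f₄ ⟩
    expand₂ f₁ ^ 2                ∎
    where open ≈-Reasoning

-- Reading the series identities coefficientwise

module Sections where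

  open PowerSeries
  open QSeries
  open GeneratingFunction

  opaque
    unfolding _⊞_

    f₁-coeff-0 : f₁ 0 ≡ 1F
    f₁-coeff-0 = ≡.refl

    ψ-coeff-0 : ψ 0 ≡ 1F
    ψ-coeff-0 = ≡.refl

    φ-coeff-0 : φ 0 ≡ 1F
    φ-coeff-0 = ≡.refl

  open Dissection.Theta f₁ ψ φ f₁-coeff-0 ψ-coeff-0 φ-coeff-0 ψf₁≈f₂² φf₂≈f₁² U₁ψ≈ψ³ U₂ψ≈0 U₀φ≈φ³ U₂φ≈0

  opaque
    unfolding U ⊟_

    -- The index is left as 9(9n + 5) + 6 so that the step can be iterated along n ↦ 9n + 5.
    b-81n+51 : ∀ n → ⌊ b (9 ℕ.* (9 ℕ.* n ℕ.+ 5) ℕ.+ 6) ⌋₃ ≡ 𝔽₃.- ⌊ b (9 ℕ.* n ℕ.+ 6) ⌋₃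
    b-81n+51 n = ≡.trans (cong B (source n)) (≡.trans (coeff (U₁U₂C≈-C B Bf₁f₄³≈f₂²) n) (cong (λ m → 𝔽₃.- B m) (target n)))
      where
      source : ∀ n → 9 ℕ.* (9 ℕ.* n ℕ.+ 5) ℕ.+ 6 ≡ (((n ℕ.* 3 ℕ.+ 1) ℕ.* 3 ℕ.+ 2) ℕ.* 3 ℕ.+ 2) ℕ.* 3 ℕ.+ 0
      source = solve-∀
      target : ∀ n → (n ℕ.* 3 ℕ.+ 2) ℕ.* 3 ℕ.+ 0 ≡ 9 ℕ.* n ℕ.+ 6
      target = solve-∀

    b-81n+24 : ∀ n → ⌊ b (81 ℕ.* n ℕ.+ 24) ⌋₃ ≡ 𝔽₃.- ⌊ b (9 ℕ.* n ℕ.+ 3) ⌋₃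
    b-81n+24 n = ≡.trans (cong B (source n)) (≡.trans (coeff (U₀U₂C≈-D B Bf₁f₄³≈f₂²) n) (cong (λ m → 𝔽₃.- B m) (target n)))
      where
      source : ∀ n → 81 ℕ.* n ℕ.+ 24 ≡ (((n ℕ.* 3 ℕ.+ 0) ℕ.* 3 ℕ.+ 2) ℕ.* 3 ℕ.+ 2) ℕ.* 3 ℕ.+ 0
      source = solve-∀
      target : ∀ n → (n ℕ.* 3 ℕ.+ 1) ℕ.* 3 ℕ.+ 0 ≡ 9 ℕ.* n ℕ.+ 3
      target = solve-∀

-- From 𝔽₃ back to integer congruences

open GeneratingFunction using (⌊_⌋₃)
open import Data.Nat.Base using (_+_; _*_; _^_; _/_)

⌊⌋₃-+ : ∀ m n → ⌊ m + n ⌋₃ ≡ ⌊ m ⌋₃ 𝔽₃.+ ⌊ n ⌋₃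
⌊⌋₃-+ zero    n = ≡.refl
⌊⌋₃-+ (suc m) n = ≡.trans (cong (1F 𝔽₃.+_) (⌊⌋₃-+ m n)) (≡.sym (𝔽₃.+-assoc 1F ⌊ m ⌋₃ ⌊ n ⌋₃))

⌊⌋₃≡0⇒3∣ : ∀ n → ⌊ n ⌋₃ ≡ 0F → 3 ∣ n
⌊⌋₃≡0⇒3∣ 0                   _  = 3 ∣0
⌊⌋₃≡0⇒3∣ (suc (suc (suc n))) eq = ∣m∣n⇒∣m+n ∣-refl (⌊⌋₃≡0⇒3∣ n (≡.trans (≡.sym (𝔽₃.next³ ⌊ n ⌋₃)) eq))

-- The difference from a negative is the sum `m + n`, so divisibility can be tested on a natural
-- number.
⌊⌋₃-neg : ∀ m n → ⌊ m ⌋₃ ≡ 𝔽₃.- ⌊ n ⌋₃ → ℤ.+ m ≈ ℤ.- (ℤ.+ n) [mod 3 ]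
⌊⌋₃-neg m n eq = ≡.subst (λ i → ℤ.+ 3 ℤ∣.∣ (ℤ.+ m ℤ.+ i)) (≡.sym (ℤ.neg-involutive (ℤ.+ n)))
  (⌊⌋₃≡0⇒3∣ (m + n) (≡.trans (⌊⌋₃-+ m n) (≡.trans (cong (𝔽₃._+ ⌊ n ⌋₃) eq) (𝔽₃.-‿inverseˡ ⌊ n ⌋₃))))

≈-neg-trans : ∀ i j e k → i ≈ ℤ.- j [mod 3 ] → j ≈ e ℤ.* k [mod 3 ] → i ≈ (-1ℤ ℤ.* e) ℤ.* k [mod 3 ]
≈-neg-trans i j e k p q = ≡.subst (ℤ.+ 3 ℤ∣.∣_) (identity i j e k)
  (Signed.∣⇒∣ᵤ {k = ℤ.+ 3} (Signed.∣m∣n⇒∣m-n (Signed.∣ᵤ⇒∣ {k = ℤ.+ 3} {i = i ℤ.- ℤ.- j} p) (Signed.∣ᵤ⇒∣ {k = ℤ.+ 3} {i = j ℤ.- e ℤ.* k} q)))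
  where
  identity : ∀ i j e k → (i ℤ.- ℤ.- j) ℤ.- (j ℤ.- e ℤ.* k) ≡ i ℤ.- (-1ℤ ℤ.* e) ℤ.* k
  identity = ℤRing.solve-∀

-- 5 (9ᵏ - 1) / 8
offset : ℕ → ℕ
offset zero    = 0
offset (suc k) = 9 * offset k + 5

5*9^k : ∀ k → 5 * 9 ^ k ≡ 8 * offset k + 5
5*9^k zero    = ≡.refl
5*9^k (suc k) = ≡.trans (swap (9 ^ k)) (≡.trans (cong (9 *_) (5*9^k k)) (expand (offset k)))
  where
  swap : ∀ e → 5 * (9 * e) ≡ 9 * (5 * e)
  swap = solve-∀
  expand : ∀ t → 9 * (8 * t + 5) ≡ 8 * (9 * t + 5) + 5
  expand = solve-∀

-- By `5*9^k` at `suc k` the numerator is 8(9 · `offset k` + 6), so the division is exact.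
index : ∀ n k → 3 ^ (2 * suc k) * n + (5 * 3 ^ (2 * suc k) + 3) / 8 ≡ 9 * (9 ^ k * n + offset k) + 6
index n k = begin
  3 ^ (2 * suc k) * n + (5 * 3 ^ (2 * suc k) + 3) / 8
    ≡⟨ cong (λ e → e * n + (5 * e + 3) / 8) (ℕ.^-*-assoc 3 2 (suc k)) ⟨
  9 * 9 ^ k * n + (5 * (9 * 9 ^ k) + 3) / 8
    ≡⟨ cong (λ e → 9 * 9 ^ k * n + (e + 3) / 8) (5*9^k (suc k)) ⟩
  9 * 9 ^ k * n + (8 * (9 * offset k + 5) + 5 + 3) / 8
    ≡⟨ cong (λ e → 9 * 9 ^ k * n + e / 8) (multiple (offset k)) ⟩
  9 * 9 ^ k * n + (9 * offset k + 6) * 8 / 8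
    ≡⟨ cong (9 * 9 ^ k * n +_) (m*n/n≡m (9 * offset k + 6) 8) ⟩
  9 * 9 ^ k * n + (9 * offset k + 6)
    ≡⟨ collect (9 ^ k) n (offset k) ⟩
  9 * (9 ^ k * n + offset k) + 6 ∎
  where
  open ≡-Reasoning
  multiple : ∀ t → 8 * (9 * t + 5) + 5 + 3 ≡ (9 * t + 6) * 8
  multiple = solve-∀
  collect : ∀ e n t → 9 * e * n + (9 * t + 6) ≡ 9 * (e * n + t) + 6
  collect = solve-∀

-- The k-fold iterate of n ↦ 9n + 5 sends `n` to `9 ^ k * n + offset k`, and each step of it changes
-- the sign.
b-family : ∀ n k → ℤ.+ b (9 * (9 ^ k * n + offset k) + 6) ≈ -1ℤ ℤ.^ k ℤ.* ℤ.+ b (9 * n + 6) [mod 3 ]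
b-family n zero    = ≡.subst (λ i → ℤ.+ 3 ℤ∣.∣ i) (≡.sym (ℤ.i≡j⇒i-j≡0 (≡.trans (cong (λ m → ℤ.+ b m) (base n)) (≡.sym (ℤ.*-identityˡ _))))) (3 ∣0)
  where
  base : ∀ n → 9 * (1 * n + 0) + 6 ≡ 9 * n + 6
  base = solve-∀
b-family n (suc k) = ≈-neg-trans (ℤ.+ b (9 * (9 ^ suc k * n + offset (suc k)) + 6)) (ℤ.+ b (9 * (9 ^ k * n + offset k) + 6)) (-1ℤ ℤ.^ k) (ℤ.+ b (9 * n + 6))
  (⌊⌋₃-neg (b (9 * (9 ^ suc k * n + offset (suc k)) + 6)) (b (9 * (9 ^ k * n + offset k) + 6)) (≡.trans (cong (λ m → ⌊ b m ⌋₃) (step (9 ^ k) n (offset k))) (Sections.b-81n+51 (9 ^ k * n + offset k))))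
  (b-family n k)
  where
  step : ∀ e n t → 9 * (9 * e * n + (9 * t + 5)) + 6 ≡ 9 * (9 * (e * n + t) + 5) + 6
  step = solve-∀

theorem1p2 : (∀ (n k : ℕ) → ℤ.+ b (3 ^ (2 * suc k) * n + (5 * 3 ^ (2 * suc k) + 3) / 8) ≈ -1ℤ ℤ.^ k ℤ.* ℤ.+ b (9 * n + 6) [mod 3 ])
    × (∀ (n : ℕ) → ℤ.+ b (81 * n + 24) ≈ ℤ.- (ℤ.+ b (9 * n + 3)) [mod 3 ])
theorem1p2 =
  (λ n k → ≡.subst (λ m → ℤ.+ b m ≈ -1ℤ ℤ.^ k ℤ.* ℤ.+ b (9 * n + 6) [mod 3 ]) (≡.sym (index n k)) (b-family n k)) ,
  (λ n → ⌊⌋₃-neg (b (81 * n + 24)) (b (9 * n + 3)) (Sections.b-81n+24 n))
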